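{- Let $G$ be an edge-colored graph of order $n\geq 3$. If $e(G)+c(G)\geq\binom{n+1}{2}$ and $G$ contains exactly one rainbow triangle, then $G$ belongs to $\mathcal{G}_1$.
   Context: Graphs are finite and simple. An edge-colored graph is a graph $G$ with a map $C:E(G)\to\mathbb{N}$. $e(G)$ is the number of edges and $c(G)$ the number of distinct colors on $E(G)$. A subgraph is rainbow if all its edges have distinct colors; monochromatic if all its edges have the same color. For disjoint $S,S'\subseteq V(G)$, $G[S,S']$ is the bipartite subgraph with classes $S,S'$ and edges of $G$ between them. The class $\mathcal{G}_0$ of edge-colored complete graphs is defined recursively: $K_1\in\mathcal{G}_0$; an edge-colored complete graph $G$ of order $n\geq 2$ is in $\mathcal{G}_0$ iff $c(G)=n-1$ and there is a bipartition $V(G)=V_1\cup V_2$ into nonempty sets with $G[V_1,V_2]$ monochromatic and $G[V_1],G[V_2]\in\mathcal{G}_0$. The class $\mathcal{G}_1$ of edge-colored complete graphs is defined by: the rainbow triangle $C_3$ is in $\mathcal{G}_1$; an edge-colored complete graph $G$ of order $n\geq 4$ is in $\mathcal{G}_1$ iff $c(G)=n$ and there is a bipartition $V(G)=V_1\cup V_2$ with $G[V_1,V_2]$ monochromatic, $G[V_1]\in\mathcal{G}_1$ and $G[V_2]\in\mathcal{G}_0$. -}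

module Defs where

open import Data.Nat using (ℕ; zero; suc; _+_; _∸_; _≤_; _<_; _<ᵇ_)
open import Data.Nat.Properties using (_≟_)
open import Data.Bool using (Bool; true; false; _∧_; not; if_then_else_)
open import Data.Fin using (Fin; toℕ)
open import Data.List using (List; []; _∷_; length; map; filter; concatMap; allFin; deduplicate)
open import Data.Product using (_×_; _,_; ∃; Σ)
open import Relation.Binary.PropositionalEquality using (_≡_; _≢_)
open import Relation.Nullary.Decidable using (does)
open import Relation.Nullary using (¬_)
open import Relation.Unary using (Pred)
open import Data.Bool.Properties using (T?)
open import Data.Bool using (T)

-- An edge-colored (finite, simple) graph on vertex set Fin n.
-- adj is the adjacency relation (symmetric, irreflexive); col assigns a
-- colour in ℕ to each pair of vertices; only its values on edges matter.
record ECGraph (n : ℕ) : Set where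
  field
    adj     : Fin n → Fin n → Bool
    adj-sym : ∀ i j → adj i j ≡ adj j i
    adj-irr : ∀ i → adj i i ≡ false
    col     : Fin n → Fin n → ℕ
    col-sym : ∀ i j → adj i j ≡ true → col i j ≡ col j i
open ECGraph public

VSet : ℕ → Set
VSet n = Fin n → Bool

full : ∀ {n} → VSet n
full _ = true

size : ∀ {n} → VSet n → ℕ
size {n} S = length (filter (λ i → T? (S i)) (allFin n))

pairsIn : ∀ {n} → VSet n → List (Fin n × Fin n)
pairsIn {n} S =
  concatMap (λ i → map (λ j → (i , j))
    (filter (λ j → T? (S i ∧ S j ∧ (toℕ i <ᵇ toℕ j))) (allFin n))) (allFin n)

edgesIn : ∀ {n} → ECGraph n → VSet n → List (Fin n × Fin n)
edgesIn G S = filter (λ p → T? (adj G (Data.Product.proj₁ p) (Data.Product.proj₂ p))) (pairsIn S)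

eIn : ∀ {n} → ECGraph n → VSet n → ℕ
eIn G S = length (edgesIn G S)

cIn : ∀ {n} → ECGraph n → VSet n → ℕ
cIn G S = length (deduplicate _≟_
  (map (λ p → col G (Data.Product.proj₁ p) (Data.Product.proj₂ p)) (edgesIn G S)))

eG : ∀ {n} → ECGraph n → ℕ
eG G = eIn G full

cG : ∀ {n} → ECGraph n → ℕ
cG G = cIn G full

rainbowTriangles : ∀ {n} → ECGraph n → List (Fin n × Fin n × Fin n)
rainbowTriangles {n} G =
  filter (λ t → T? (isRT t))
    (concatMap (λ a → concatMap (λ b → map (λ c → (a , b , c)) (allFin n)) (allFin n)) (allFin n))
  where
  neq : ℕ → ℕ → Bool
  neq x y = not (does (x ≟ y))
  isRT : Fin n × Fin n × Fin n → Bool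
  isRT (a , b , c) =
    (toℕ a <ᵇ toℕ b) ∧ (toℕ b <ᵇ toℕ c) ∧
    adj G a b ∧ adj G b c ∧ adj G a c ∧
    neq (col G a b) (col G b c) ∧ neq (col G a b) (col G a c) ∧ neq (col G b c) (col G a c)

Complete : ∀ {n} → ECGraph n → VSet n → Set
Complete G S = ∀ i j → S i ≡ true → S j ≡ true → i ≢ j → adj G i j ≡ true

Bipartition : ∀ {n} → VSet n → VSet n → VSet n → Set
Bipartition S V₁ V₂ =
  (∀ i → S i ≡ true → (V₁ i ≡ true) Data.Sum.⊎ (V₂ i ≡ true)) ×
  (∀ i → V₁ i ≡ true → S i ≡ true) ×
  (∀ i → V₂ i ≡ true → S i ≡ true) ×
  (∀ i → V₁ i ≡ true → V₂ i ≡ true → Data.Empty.⊥)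
  where import Data.Sum; import Data.Empty

NonEmpty : ∀ {n} → VSet n → Set
NonEmpty S = ∃ λ i → S i ≡ true

Mono : ∀ {n} → ECGraph n → VSet n → VSet n → Set
Mono G V₁ V₂ = ∃ λ (κ : ℕ) → ∀ i j → V₁ i ≡ true → V₂ j ≡ true → col G i j ≡ κ

data IsG0 {n : ℕ} (G : ECGraph n) (S : VSet n) : Set where
  g0-K1    : size S ≡ 1 → IsG0 G S
  g0-split : 2 ≤ size S → Complete G S → cIn G S ≡ size S ∸ 1 →
             (V₁ V₂ : VSet n) → Bipartition S V₁ V₂ → NonEmpty V₁ → NonEmpty V₂ →
             Mono G V₁ V₂ → IsG0 G V₁ → IsG0 G V₂ → IsG0 G S

data IsG1 {n : ℕ} (G : ECGraph n) (S : VSet n) : Set where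
  g1-C3    : size S ≡ 3 → Complete G S → cIn G S ≡ 3 → IsG1 G S
  g1-split : 4 ≤ size S → Complete G S → cIn G S ≡ size S →
             (V₁ V₂ : VSet n) → Bipartition S V₁ V₂ →
             Mono G V₁ V₂ → IsG1 G V₁ → IsG0 G V₂ → IsG1 G S

{-# OPTIONS --safe #-}

-- Write f = e + c and t(m) = m(m+1)/2, and let v have minimum degree.  The neighbours of v reached by
-- one edge of each colour seen only at v are pairwise non-adjacent if there is no rainbow triangle, so
-- d(v) plus their number is at most n.  Deleting v therefore gives f < t(n) by induction, and
-- f = t(n) − 1 leaves only G − v in 𝒢₀ plus one new colour at v; the split of G − v then extends to G.
-- Now let G have exactly one rainbow triangle xyz and f ≥ t(n).  If a colour of this triangle occurred
-- on a further edge, deleting its triangle edge would give an incomplete graph without rainbow triangle and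
-- f ≥ t(n) − 1, which is impossible.  So these colours are unique, and giving xy the colour of xz
-- destroys the rainbow triangle at the cost of one colour: the result lies in 𝒢₀.  Its splits never
-- separate x, y, z while a fourth vertex is left, and undoing the recolouring turns them into splits for 𝒢₁.
module Submission where

open import Defs
open import Data.Bool using (true; false; T; _∧_; _∨_; not; if_then_else_)
open import Data.Bool.Properties using (T?; T-≡)
open import Data.Fin using (Fin; toℕ)
import Data.Fin.Properties as Fin
open import Data.List using (List; []; _∷_; _++_; length; map; filter; concatMap; allFin; deduplicate)
open import Data.List.Properties using (length-map; length-++; length-tabulate; filter-all)
open import Data.List.Extrema.Nat using (argmin; argmin-all; f[argmin]≤f[xs])
open import Data.List.Membership.Propositional using (_∈_; _∉_)
open import Data.List.Membership.Propositional.Properties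
open import Data.List.Relation.Unary.Any using (here; there; any?)
open import Data.List.Relation.Unary.All as All using (All; []; _∷_)
import Data.List.Relation.Unary.All.Properties as All
open import Data.List.Relation.Unary.AllPairs as AllPairs using ([]; _∷_)
import Data.List.Relation.Unary.AllPairs.Properties as AllPairs
open import Data.List.Relation.Unary.Unique.Propositional using (Unique)
import Data.List.Relation.Unary.Unique.Propositional.Properties as Unique
open import Data.List.Relation.Unary.Unique.DecPropositional.Properties using (deduplicate-!)
open import Data.List.Relation.Binary.Subset.Propositional using (_⊆_)
open import Data.Nat using (ℕ; zero; suc; _+_; _∸_; _≤_; _<_; _<ᵇ_; z≤n; s≤s)
open import Data.Nat.Combinatorics using (_C_; nC1≡n; nCk+nC[k+1]≡[n+1]C[k+1])
open import Data.Nat.Properties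
open import Data.List.Membership.DecPropositional _≟_ using (_∈?_)
open import Data.Nat.Tactic.RingSolver using (solve-∀)
open import Data.Product using (_×_; _,_; ∃; proj₁; proj₂)
open import Data.Sum as Sum using (_⊎_; inj₁; inj₂)
open import Function using (_∘_; id; flip; Equivalence; mk⇔)
open import Relation.Binary using (tri<; tri≈; tri>)
open import Relation.Binary.PropositionalEquality
open import Relation.Nullary using (¬_; Dec; yes; no; does; contradiction)
open import Relation.Nullary.Decidable using (dec-true; dec-false; does-⇔; _×-dec_; _⊎-dec_; ¬?)

private variable
  n : ℕ
  A B : Set

T⇒≡ : ∀ {b} → T b → b ≡ true
T⇒≡ = Equivalence.to T-≡

≡⇒T : ∀ {b} → b ≡ true → T b
≡⇒T = Equivalence.from T-≡

∧⁺ : ∀ {a b} → a ≡ true → b ≡ true → a ∧ b ≡ true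
∧⁺ refl refl = refl

∧⁻ : ∀ {a b} → a ∧ b ≡ true → a ≡ true × b ≡ true
∧⁻ {true} {true} _ = refl , refl

∨⁻ : ∀ {a b} → a ∨ b ≡ true → a ≡ true ⊎ b ≡ true
∨⁻ {true} _ = inj₁ refl
∨⁻ {false} p = inj₂ p

∨⁺ˡ : ∀ {a b} → a ≡ true → a ∨ b ≡ true
∨⁺ˡ refl = refl

∨⁺ʳ : ∀ {a b} → b ≡ true → a ∨ b ≡ true
∨⁺ʳ {true} _ = refl
∨⁺ʳ {false} p = p

not⁺ : ∀ {b} → ¬ b ≡ true → not b ≡ true
not⁺ {true}  p = contradiction refl p
not⁺ {false} _ = refl

not⁻ : ∀ {b} → not b ≡ true → ¬ b ≡ true
not⁻ {false} _ ()

does⁻ : (a? : Dec A) → does a? ≡ true → A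
does⁻ (yes a) _ = a

length-mono-unique : ∀ {xs ys : List A} → Unique xs → xs ⊆ ys → length xs ≤ length ys
length-mono-unique {xs = []} _ _ = z≤n
length-mono-unique {xs = x ∷ xs} (x∉ ∷ u) sub with ∈-∃++ (sub (here refl))
... | as , bs , refl = begin
  suc (length xs)            ≤⟨ s≤s (length-mono-unique u sub′) ⟩
  suc (length (as ++ bs))    ≡⟨ cong suc (length-++ as) ⟩
  suc (length as + length bs) ≡⟨ +-suc (length as) (length bs) ⟨
  length as + suc (length bs) ≡⟨ length-++ as ⟨
  length (as ++ x ∷ bs)      ∎
  where
  open ≤-Reasoning
  sub′ : xs ⊆ as ++ bs
  sub′ {y} y∈ with ∈-++⁻ as (sub (there y∈))
  ... | inj₁ y∈as           = ∈-++⁺ˡ y∈as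
  ... | inj₂ (here refl)    = contradiction refl (All.lookup x∉ y∈)
  ... | inj₂ (there y∈bs)   = ∈-++⁺ʳ as y∈bs

unique-map-injective : ∀ (f : A → B) {xs x y} → Unique (map f xs) →
                       x ∈ xs → y ∈ xs → f x ≡ f y → x ≡ y
unique-map-injective f (p ∷ u) (here refl) (here refl) _ = refl
unique-map-injective f (p ∷ u) (here refl) (there y∈) eq =
  contradiction eq (All.lookup p (∈-map⁺ f y∈))
unique-map-injective f (p ∷ u) (there x∈) (here refl) eq =
  contradiction (sym eq) (All.lookup p (∈-map⁺ f x∈))
unique-map-injective f (p ∷ u) (there x∈) (there y∈) eq = unique-map-injective f u x∈ y∈ eq

preimages : {P : A → Set} (f : A → B) (ys : List B) → (∀ {y} → y ∈ ys → ∃ λ x → P x × f x ≡ y) →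
            ∃ λ xs → All P xs × map f xs ≡ ys
preimages f [] g = [] , [] , refl
preimages f (y ∷ ys) g with g (here refl) | preimages f ys (g ∘ there)
... | x , px , refl | xs , pxs , refl = x ∷ xs , px ∷ pxs , refl

-- Vertex sets

infix 4 _∈ˢ_
_∈ˢ_ : Fin n → VSet n → Set
i ∈ˢ S = S i ≡ true

infixl 7 _∩_ _∖_
infixl 6 _∪_
_∩_ _∪_ _∖_ : VSet n → VSet n → VSet n
(S ∩ P) i = S i ∧ P i
(S ∪ P) i = S i ∨ P i
(S ∖ P) i = S i ∧ not (P i)

∩⁻ : ∀ (S P : VSet n) {i} → i ∈ˢ S ∩ P → i ∈ˢ S × i ∈ˢ P
∩⁻ _ _ = ∧⁻

∖⁺ : ∀ (S P : VSet n) {i} → i ∈ˢ S → ¬ i ∈ˢ P → i ∈ˢ S ∖ P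
∖⁺ _ _ i∈ i∉ = ∧⁺ i∈ (not⁺ i∉)

∖⁻ : ∀ (S P : VSet n) {i} → i ∈ˢ S ∖ P → i ∈ˢ S × ¬ i ∈ˢ P
∖⁻ _ _ i∈ with ∧⁻ i∈
... | i∈S , i∉P = i∈S , not⁻ i∉P

⁅_⁆ : Fin n → VSet n
⁅ v ⁆ i = does (i Fin.≟ v)

v∈⁅v⁆ : (v : Fin n) → v ∈ˢ ⁅ v ⁆
v∈⁅v⁆ v = dec-true (v Fin.≟ v) refl

∈⁅⁆⁻ : {i v : Fin n} → i ∈ˢ ⁅ v ⁆ → i ≡ v
∈⁅⁆⁻ {i = i} {v} = does⁻ (i Fin.≟ v)

∈∖⁅⁆⁺ : ∀ (S : VSet n) {i v} → i ∈ˢ S → i ≢ v → i ∈ˢ S ∖ ⁅ v ⁆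
∈∖⁅⁆⁺ S {v = v} i∈ i≢v = ∖⁺ S ⁅ v ⁆ i∈ (i≢v ∘ ∈⁅⁆⁻)

∈∖⁅⁆⁻ : ∀ (S : VSet n) {i v} → i ∈ˢ S ∖ ⁅ v ⁆ → i ∈ˢ S × i ≢ v
∈∖⁅⁆⁻ S {i} {v} p with ∖⁻ S ⁅ v ⁆ p
... | i∈S , i∉v = i∈S , λ { refl → i∉v (v∈⁅v⁆ v) }

∩∖-bipartition : (S P : VSet n) → Bipartition S (S ∩ P) (S ∖ P)
∩∖-bipartition S P = cover , (λ _ → proj₁ ∘ ∩⁻ S P) , (λ _ → proj₁ ∘ ∖⁻ S P) ,
                     λ _ p q → proj₂ (∖⁻ S P q) (proj₂ (∩⁻ S P p))
  where
  cover : ∀ i → i ∈ˢ S → i ∈ˢ S ∩ P ⊎ i ∈ˢ S ∖ P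
  cover i i∈ with P i
  ... | true  = inj₁ (∧⁺ i∈ refl)
  ... | false = inj₂ (∧⁺ i∈ refl)

elems : VSet n → List (Fin n)
elems {n} S = filter (λ i → T? (S i)) (allFin n)

∈-elems⁺ : ∀ (S : VSet n) {i} → i ∈ˢ S → i ∈ elems S
∈-elems⁺ S i∈ = ∈-filter⁺ _ (∈-allFin _) (≡⇒T i∈)

∈-elems⁻ : ∀ (S : VSet n) {i} → i ∈ elems S → i ∈ˢ S
∈-elems⁻ {n} S p = T⇒≡ (proj₂ (∈-filter⁻ (λ i → T? (S i)) {xs = allFin n} p))

elems-unique : (S : VSet n) → Unique (elems S)
elems-unique S = Unique.filter⁺ _ (Unique.allFin⁺ _)

size≤length : ∀ (S : VSet n) {xs} → (∀ {i} → i ∈ˢ S → i ∈ xs) → size S ≤ length xs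
size≤length S sub = length-mono-unique (elems-unique S) (sub ∘ ∈-elems⁻ S)

length≤size : ∀ (S : VSet n) {xs} → Unique xs → (∀ {i} → i ∈ xs → i ∈ˢ S) → length xs ≤ size S
length≤size S u sub = length-mono-unique u (∈-elems⁺ S ∘ sub)

size-mono : ∀ (S R : VSet n) → (∀ {i} → i ∈ˢ S → i ∈ˢ R) → size S ≤ size R
size-mono S R sub = size≤length S (∈-elems⁺ R ∘ sub)

size-bipartition : ∀ (S V₁ V₂ : VSet n) → Bipartition S V₁ V₂ → size S ≡ size V₁ + size V₂
size-bipartition S V₁ V₂ (cover , sub₁ , sub₂ , disj) =
  trans (≤-antisym (size≤length S into) (length≤size S uniq from)) (length-++ (elems V₁))
  where
  into : ∀ {i} → i ∈ˢ S → i ∈ elems V₁ ++ elems V₂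
  into {i} p with cover i p
  ... | inj₁ q = ∈-++⁺ˡ (∈-elems⁺ V₁ q)
  ... | inj₂ q = ∈-++⁺ʳ (elems V₁) (∈-elems⁺ V₂ q)
  from : ∀ {i} → i ∈ elems V₁ ++ elems V₂ → i ∈ˢ S
  from {i} p with ∈-++⁻ (elems V₁) p
  ... | inj₁ q = sub₁ i (∈-elems⁻ V₁ q)
  ... | inj₂ q = sub₂ i (∈-elems⁻ V₂ q)
  uniq : Unique (elems V₁ ++ elems V₂)
  uniq = Unique.++⁺ (elems-unique V₁) (elems-unique V₂)
           λ (p , q) → disj _ (∈-elems⁻ V₁ p) (∈-elems⁻ V₂ q)

size-pos : ∀ (S : VSet n) → NonEmpty S → 1 ≤ size S
size-pos S (v , v∈) = length≤size S {v ∷ []} ([] ∷ []) λ { (here refl) → v∈ }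

size-nonempty : ∀ (S : VSet n) → 1 ≤ size S → NonEmpty S
size-nonempty S 1≤ with elems S in eq
... | x ∷ _ = x , ∈-elems⁻ S (subst (x ∈_) (sym eq) (here refl))

size-∖⁅⁆ : ∀ (S : VSet n) {v} → v ∈ˢ S → size S ≡ suc (size (S ∖ ⁅ v ⁆))
size-∖⁅⁆ S {v} v∈ = begin
  size S                                   ≡⟨ size-bipartition S _ _ (∩∖-bipartition S ⁅ v ⁆) ⟩
  size (S ∩ ⁅ v ⁆) + size (S ∖ ⁅ v ⁆)     ≡⟨ cong (_+ size (S ∖ ⁅ v ⁆)) size≡1 ⟩
  suc (size (S ∖ ⁅ v ⁆))                   ∎
  where
  open ≡-Reasoning
  size≡1 : size (S ∩ ⁅ v ⁆) ≡ 1
  size≡1 = ≤-antisym (size≤length (S ∩ ⁅ v ⁆) {v ∷ []} (here ∘ ∈⁅⁆⁻ ∘ proj₂ ∘ ∩⁻ S ⁅ v ⁆))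
                     (size-pos (S ∩ ⁅ v ⁆) (v , ∧⁺ v∈ (v∈⁅v⁆ v)))

size-full : ∀ n → size (full {n}) ≡ n
size-full n = trans (cong length (filter-all (λ i → T? (full i)) (All.tabulate⁺ {n = n} λ _ → _)))
                    (length-tabulate {n = n} id)

find-∈ˢ : (S : VSet n) → NonEmpty S ⊎ (∀ {i} → ¬ i ∈ˢ S)
find-∈ˢ S with Fin.any? (λ i → S i Data.Bool.≟ true)
... | yes p = inj₁ p
... | no ¬p = inj₂ λ {i} i∈ → ¬p (_ , i∈)

tri : ℕ → ℕ
tri zero = 0
tri (suc m) = suc m + tri m

[n+1]C2≡tri : ∀ n → (n + 1) C 2 ≡ tri n
[n+1]C2≡tri zero = refl
[n+1]C2≡tri (suc n) = begin
  suc (n + 1) C 2              ≡⟨ nCk+nC[k+1]≡[n+1]C[k+1] (n + 1) 1 ⟨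
  (n + 1) C 1 + (n + 1) C 2    ≡⟨ cong₂ _+_ (trans (nC1≡n (n + 1)) (+-comm n 1)) ([n+1]C2≡tri n) ⟩
  suc n + tri n                ∎
  where open ≡-Reasoning

-- Edges and colours

Edge : ECGraph n → VSet n → Fin n → Fin n → Set
Edge G S i j = i ∈ˢ S × j ∈ˢ S × adj G i j ≡ true

adj⇒≢ : (G : ECGraph n) → ∀ {i j} → adj G i j ≡ true → i ≢ j
adj⇒≢ G {i} e refl with trans (sym e) (adj-irr G i)
... | ()

adj-flip : (G : ECGraph n) → ∀ {i j} → adj G i j ≡ true → adj G j i ≡ true
adj-flip G {i} {j} e = trans (adj-sym G j i) e

edge-flip : (G : ECGraph n) (S : VSet n) → ∀ {i j} → Edge G S i j → Edge G S j i
edge-flip G S (i∈ , j∈ , e) = j∈ , i∈ , adj-flip G e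

above : VSet n → Fin n → VSet n
above S i j = S i ∧ S j ∧ (toℕ i <ᵇ toℕ j)

∈-pairsIn⁺ : ∀ (S : VSet n) {i j} → i ∈ˢ S → j ∈ˢ S → toℕ i < toℕ j → (i , j) ∈ pairsIn S
∈-pairsIn⁺ S {i} {j} i∈ j∈ i<j = ∈-concat⁺′
  (∈-map⁺ (i ,_) (∈-elems⁺ (above S i) (∧⁺ i∈ (∧⁺ j∈ (T⇒≡ (<⇒<ᵇ i<j))))))
  (∈-map⁺ (λ i → map (i ,_) (elems (above S i))) (∈-allFin i))

∈-pairsIn⁻ : ∀ (S : VSet n) {i j} → (i , j) ∈ pairsIn S → i ∈ˢ S × j ∈ˢ S × toℕ i < toℕ j
∈-pairsIn⁻ {n} S {i} {j} p with ∈-concat⁻′ (map (λ i → map (i ,_) (elems (above S i))) (allFin n)) p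
... | _ , p∈ , q with ∈-map⁻ (λ i → map (i ,_) (elems (above S i))) q
... | i′ , _ , refl with ∈-map⁻ (i′ ,_) p∈
... | _ , j∈ , refl with ∧⁻ {S i} (∈-elems⁻ (above S i) j∈)
... | i∈ , r with ∧⁻ {S j} r
... | j∈ , i<j = i∈ , j∈ , <ᵇ⇒< _ _ (≡⇒T i<j)

pairsIn-unique : (S : VSet n) → Unique (pairsIn S)
pairsIn-unique {n} S = Unique.concat⁺
  (All.map⁺ (All.tabulate λ {i} _ → Unique.map⁺ (λ { refl → refl }) (elems-unique (above S i))))
  (AllPairs.map⁺ (AllPairs.map disjoint (Unique.allFin⁺ n)))
  where
  disjoint : ∀ {i i′} → i ≢ i′ → ∀ {p} →
             ¬ (p ∈ map (i ,_) (elems (above S i)) × p ∈ map (i′ ,_) (elems (above S i′)))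
  disjoint i≢i′ (p∈ , p∈′) with ∈-map⁻ _ p∈ | ∈-map⁻ _ p∈′
  ... | _ , _ , refl | _ , _ , refl = i≢i′ refl

edgesIn-unique : (G : ECGraph n) (S : VSet n) → Unique (edgesIn G S)
edgesIn-unique G S = Unique.filter⁺ _ (pairsIn-unique S)

∈-edgesIn⁺ : (G : ECGraph n) (S : VSet n) → ∀ {i j} → Edge G S i j → toℕ i < toℕ j →
             (i , j) ∈ edgesIn G S
∈-edgesIn⁺ G S (i∈ , j∈ , e) i<j = ∈-filter⁺ _ (∈-pairsIn⁺ S i∈ j∈ i<j) (≡⇒T e)

∈-edgesIn⁻ : (G : ECGraph n) (S : VSet n) → ∀ {i j} → (i , j) ∈ edgesIn G S →
             Edge G S i j × toℕ i < toℕ j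
∈-edgesIn⁻ G S p with ∈-filter⁻ (λ p → T? (adj G (proj₁ p) (proj₂ p))) {xs = pairsIn S} p
... | q , e with ∈-pairsIn⁻ S q
... | i∈ , j∈ , i<j = (i∈ , j∈ , T⇒≡ e) , i<j

ordered : Fin n → Fin n → Fin n × Fin n
ordered i j = if toℕ i <ᵇ toℕ j then (i , j) else (j , i)

ordered-< : ∀ {i j : Fin n} → toℕ i < toℕ j → ordered i j ≡ (i , j)
ordered-< i<j rewrite T⇒≡ (<⇒<ᵇ i<j) = refl

ordered-> : ∀ {i j : Fin n} → toℕ j < toℕ i → ordered i j ≡ (j , i)
ordered-> {i = i} {j} j<i with toℕ i <ᵇ toℕ j in eq
... | false = refl
... | true  = contradiction (<ᵇ⇒< _ _ (≡⇒T eq)) (<-asym j<i)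

ordered-injective : ∀ (v : Fin n) {i j} → ordered v i ≡ ordered v j → i ≡ j
ordered-injective v {i} {j} eq with toℕ v <ᵇ toℕ i | toℕ v <ᵇ toℕ j | eq
... | true  | true  | refl = refl
... | true  | false | refl = refl
... | false | true  | refl = refl
... | false | false | refl = refl

∈-edgesIn-ordered : (G : ECGraph n) (S : VSet n) → ∀ {i j} → Edge G S i j →
                    ordered i j ∈ edgesIn G S
∈-edgesIn-ordered G S {i} {j} e@(_ , _ , a) with <-cmp (toℕ i) (toℕ j)
... | tri< i<j _ _ = subst (_∈ edgesIn G S) (sym (ordered-< i<j)) (∈-edgesIn⁺ G S e i<j)
... | tri≈ _ i≡j _ = contradiction (Fin.toℕ-injective i≡j) (adj⇒≢ G a)
... | tri> _ _ j<i = subst (_∈ edgesIn G S) (sym (ordered-> j<i)) (∈-edgesIn⁺ G S (edge-flip G S e) j<i)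

colours : ECGraph n → VSet n → List ℕ
colours G S = map (λ p → col G (proj₁ p) (proj₂ p)) (edgesIn G S)

∈-colours⁻ : (G : ECGraph n) (S : VSet n) → ∀ {c} → c ∈ colours G S →
             ∃ λ i → ∃ λ j → Edge G S i j × col G i j ≡ c
∈-colours⁻ G S c∈ with ∈-map⁻ _ c∈
... | (i , j) , p , refl = i , j , proj₁ (∈-edgesIn⁻ G S p) , refl

∈-colours⁺ : (G : ECGraph n) (S : VSet n) → ∀ {i j} → Edge G S i j → col G i j ∈ colours G S
∈-colours⁺ G S {i} {j} e@(_ , _ , a) with <-cmp (toℕ i) (toℕ j)
... | tri< i<j _ _ = ∈-map⁺ (λ p → col G (proj₁ p) (proj₂ p)) (∈-edgesIn⁺ G S e i<j)
... | tri≈ _ i≡j _ = contradiction (Fin.toℕ-injective i≡j) (adj⇒≢ G a)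
... | tri> _ _ j<i = subst (_∈ colours G S) (sym (col-sym G i j a))
    (∈-map⁺ (λ p → col G (proj₁ p) (proj₂ p)) (∈-edgesIn⁺ G S (edge-flip G S e) j<i))

palette : ECGraph n → VSet n → List ℕ
palette G S = deduplicate _≟_ (colours G S)

∈-palette⁺ : (G : ECGraph n) (S : VSet n) → ∀ {i j} → Edge G S i j → col G i j ∈ palette G S
∈-palette⁺ G S e = ∈-deduplicate⁺ _≟_ (∈-colours⁺ G S e)

∈-palette⁻ : (G : ECGraph n) (S : VSet n) → ∀ {c} → c ∈ palette G S →
             ∃ λ i → ∃ λ j → Edge G S i j × col G i j ≡ c
∈-palette⁻ G S c∈ = ∈-colours⁻ G S (∈-deduplicate⁻ _≟_ (colours G S) c∈)

palette-unique : (G : ECGraph n) (S : VSet n) → Unique (palette G S)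
palette-unique G S = deduplicate-! _≟_ (colours G S)

cIn≤length : (G : ECGraph n) (S : VSet n) → ∀ {cs} →
             (∀ {i j} → Edge G S i j → col G i j ∈ cs) → cIn G S ≤ length cs
cIn≤length G S {cs} sub = length-mono-unique (palette-unique G S) into
  where
  into : palette G S ⊆ cs
  into c∈ with ∈-palette⁻ G S c∈
  ... | _ , _ , e , refl = sub e

degree : ECGraph n → VSet n → Fin n → ℕ
degree G S v = size (S ∩ adj G v)

eIn-∖⁅⁆ : (G : ECGraph n) (S : VSet n) → ∀ {v} → v ∈ˢ S →
          eIn G S ≡ eIn G (S ∖ ⁅ v ⁆) + degree G S v
eIn-∖⁅⁆ G S {v} v∈ = begin
  eIn G S                          ≡⟨ ≤-antisym (length-mono-unique (edgesIn-unique G S) into)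
                                                (length-mono-unique uniq from) ⟩
  length (edgesIn G S′ ++ star)    ≡⟨ length-++ (edgesIn G S′) ⟩
  eIn G S′ + length star           ≡⟨ cong (eIn G S′ +_) (length-map (ordered v) (elems N)) ⟩
  eIn G S′ + degree G S v          ∎
  where
  open ≡-Reasoning
  S′ = S ∖ ⁅ v ⁆
  N = S ∩ adj G v
  star = map (ordered v) (elems N)
  into : edgesIn G S ⊆ edgesIn G S′ ++ star
  into {i , j} p with ∈-edgesIn⁻ G S p
  ... | (i∈ , j∈ , a) , i<j with i Fin.≟ v | j Fin.≟ v
  ... | yes refl | _ = ∈-++⁺ʳ (edgesIn G S′) (subst (_∈ star) (ordered-< i<j)
                                   (∈-map⁺ (ordered v) (∈-elems⁺ N (∧⁺ j∈ a))))
  ... | no _ | yes refl = ∈-++⁺ʳ (edgesIn G S′) (subst (_∈ star) (ordered-> i<j)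
                                   (∈-map⁺ (ordered v) (∈-elems⁺ N (∧⁺ i∈ (adj-flip G a)))))
  ... | no i≢v | no j≢v = ∈-++⁺ˡ (∈-edgesIn⁺ G S′ (∈∖⁅⁆⁺ S i∈ i≢v , ∈∖⁅⁆⁺ S j∈ j≢v , a) i<j)
  from : edgesIn G S′ ++ star ⊆ edgesIn G S
  from {i , j} p with ∈-++⁻ (edgesIn G S′) p
  ... | inj₁ q with ∈-edgesIn⁻ G S′ q
  ... | (i∈ , j∈ , a) , i<j = ∈-edgesIn⁺ G S (proj₁ (∈∖⁅⁆⁻ S i∈) , proj₁ (∈∖⁅⁆⁻ S j∈) , a) i<j
  from p | inj₂ q with ∈-map⁻ (ordered v) q
  ... | x , x∈ , eq with ∩⁻ S (adj G v) (∈-elems⁻ N x∈)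
  ... | x∈S , a = subst (_∈ edgesIn G S) (sym eq) (∈-edgesIn-ordered G S (v∈ , x∈S , a))
  v∉S′ : ¬ v ∈ˢ S′
  v∉S′ v∈S′ = proj₂ (∈∖⁅⁆⁻ S v∈S′) refl
  disjoint : ∀ {p} → ¬ (p ∈ edgesIn G S′ × p ∈ star)
  disjoint {i , j} (p , q) with ∈-edgesIn⁻ G S′ p | ∈-map⁻ (ordered v) q
  ... | (i∈ , j∈ , _) , _ | x , _ , eq with toℕ v <ᵇ toℕ x | eq
  ... | true  | refl = v∉S′ i∈
  ... | false | refl = v∉S′ j∈
  uniq : Unique (edgesIn G S′ ++ star)
  uniq = Unique.++⁺ (edgesIn-unique G S′)
           (Unique.map⁺ (ordered-injective v) (elems-unique N)) disjoint

cIn-bipartition : (G : ECGraph n) (S V₁ V₂ : VSet n) → Bipartition S V₁ V₂ → Mono G V₁ V₂ →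
                  cIn G S ≤ suc (cIn G V₁ + cIn G V₂)
cIn-bipartition G S V₁ V₂ (cover , _) (κ , mono) = begin
  cIn G S                                         ≤⟨ cIn≤length G S into ⟩
  suc (length (palette G V₁ ++ palette G V₂))     ≡⟨ cong suc (length-++ (palette G V₁)) ⟩
  suc (cIn G V₁ + cIn G V₂)                       ∎
  where
  open ≤-Reasoning
  into : ∀ {i j} → Edge G S i j → col G i j ∈ κ ∷ palette G V₁ ++ palette G V₂
  into {i} {j} (i∈ , j∈ , a) with cover i i∈ | cover j j∈
  ... | inj₁ p | inj₁ q = there (∈-++⁺ˡ (∈-palette⁺ G V₁ (p , q , a)))
  ... | inj₂ p | inj₂ q = there (∈-++⁺ʳ (palette G V₁) (∈-palette⁺ G V₂ (p , q , a)))
  ... | inj₁ p | inj₂ q = here (mono i j p q)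
  ... | inj₂ p | inj₁ q = here (trans (col-sym G i j a) (mono j i q p))

-- Graphs without rainbow triangles

record Rainbow (G : ECGraph n) (a b c : Fin n) : Set where
  constructor rainbow
  field
    ab    : adj G a b ≡ true
    bc    : adj G b c ≡ true
    ac    : adj G a c ≡ true
    ab≢bc : col G a b ≢ col G b c
    ab≢ac : col G a b ≢ col G a c
    bc≢ac : col G b c ≢ col G a c

rainbow-swap : (G : ECGraph n) → ∀ {a b c} → Rainbow G a b c → Rainbow G b a c
rainbow-swap G {a} {b} {c} (rainbow ab bc ac p q r) = rainbow (adj-flip G ab) ac bc
  (q ∘ trans (col-sym G a b ab)) (p ∘ trans (col-sym G a b ab)) (≢-sym r)

rainbow-rotate : (G : ECGraph n) → ∀ {a b c} → Rainbow G a b c → Rainbow G b c a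
rainbow-rotate G {a} {b} {c} (rainbow ab bc ac p q r) = rainbow bc (adj-flip G ac) (adj-flip G ab)
  (r ∘ flip trans (sym ca)) (λ e → p (sym (trans e (sym ba)))) (λ e → q (trans ba (trans (sym e) (sym ca))))
  where
  ba = col-sym G a b ab
  ca = col-sym G a c ac

RainbowFree : ECGraph n → VSet n → Set
RainbowFree G S = ∀ {a b c} → a ∈ˢ S → b ∈ˢ S → c ∈ˢ S → ¬ Rainbow G a b c

rainbowFree-⊆ : (G : ECGraph n) → ∀ {S R} → (∀ {i} → i ∈ˢ R → i ∈ˢ S) → RainbowFree G S → RainbowFree G R
rainbowFree-⊆ G sub free a b c = free (sub a) (sub b) (sub c)

-- One neighbour of v for each colour of G[S] that occurs only at v.
record SaturatedStar (G : ECGraph n) (S : VSet n) (v : Fin n) : Set where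
  field
    leaves    : List (Fin n)
    unique    : Unique leaves
    leaf∈     : ∀ {x} → x ∈ leaves → x ∈ˢ S
    leaf-adj  : ∀ {x} → x ∈ leaves → adj G v x ≡ true
    leaf-new  : ∀ {x} → x ∈ leaves → ∀ {i j} → Edge G (S ∖ ⁅ v ⁆) i j → col G i j ≢ col G v x
    injective : ∀ {x y} → x ∈ leaves → y ∈ leaves → col G v x ≡ col G v y → x ≡ y
    bound     : cIn G S ≤ cIn G (S ∖ ⁅ v ⁆) + length leaves

saturatedStar : (G : ECGraph n) (S : VSet n) (v : Fin n) → SaturatedStar G S v
saturatedStar G S v = build (preimages (col G v) new witness)
  where
  S′ = S ∖ ⁅ v ⁆
  isNew? = λ c → ¬? (c ∈? palette G S′)
  new = filter isNew? (palette G S)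

  Leaf : Fin _ → Set
  Leaf x = x ∈ˢ S × adj G v x ≡ true × col G v x ∉ palette G S′

  witness : ∀ {c} → c ∈ new → ∃ λ x → Leaf x × col G v x ≡ c
  witness c∈ with ∈-filter⁻ isNew? {xs = palette G S} c∈
  ... | p , c∉ with ∈-palette⁻ G S p
  ... | i , j , (i∈ , j∈ , a) , refl with i Fin.≟ v | j Fin.≟ v
  ... | yes refl | _ = j , (j∈ , a , c∉) , refl
  ... | no _ | yes refl =
    i , (i∈ , adj-flip G a , c∉ ∘ subst (_∈ palette G S′) (sym (col-sym G i v a))) , sym (col-sym G i v a)
  ... | no i≢v | no j≢v = contradiction (∈-palette⁺ G S′ (∈∖⁅⁆⁺ S i∈ i≢v , ∈∖⁅⁆⁺ S j∈ j≢v , a)) c∉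

  covers : palette G S ⊆ palette G S′ ++ new
  covers {c} p with c ∈? palette G S′
  ... | yes q = ∈-++⁺ˡ q
  ... | no ¬q = ∈-++⁺ʳ (palette G S′) (∈-filter⁺ isNew? p ¬q)

  build : (∃ λ xs → All Leaf xs × map (col G v) xs ≡ new) → SaturatedStar G S v
  build (xs , leaf , eq) = record
    { leaves    = xs
    ; unique    = Unique.map⁻ uniq
    ; leaf∈     = λ x∈ → proj₁ (All.lookup leaf x∈)
    ; leaf-adj  = λ x∈ → proj₁ (proj₂ (All.lookup leaf x∈))
    ; leaf-new  = λ x∈ e eq → proj₂ (proj₂ (All.lookup leaf x∈)) (subst (_∈ palette G S′) eq (∈-palette⁺ G S′ e))
    ; injective = unique-map-injective (col G v) uniq
    ; bound     = begin
        cIn G S                              ≤⟨ length-mono-unique (palette-unique G S) covers ⟩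
        length (palette G S′ ++ new)         ≡⟨ length-++ (palette G S′) ⟩
        cIn G S′ + length new                ≡⟨ cong (λ l → cIn G S′ + length l) eq ⟨
        cIn G S′ + length (map (col G v) xs) ≡⟨ cong (cIn G S′ +_) (length-map (col G v) xs) ⟩
        cIn G S′ + length xs                 ∎
    }
    where
    open ≤-Reasoning
    uniq : Unique (map (col G v) xs)
    uniq = subst Unique (sym eq) (Unique.filter⁺ isNew? (palette-unique G S))

module _ (G : ECGraph n) (S : VSet n) (free : RainbowFree G S) where

  leaves-independent : ∀ {v} → v ∈ˢ S → (star : SaturatedStar G S v) → let open SaturatedStar star in
                       ∀ {x y} → x ∈ leaves → y ∈ leaves → ¬ adj G x y ≡ true
  leaves-independent {v} v∈ star {x} {y} x∈ y∈ a = free v∈ (leaf∈ x∈) (leaf∈ y∈)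
    (rainbow (leaf-adj x∈) a (leaf-adj y∈) (≢-sym (leaf-new x∈ xy)) (adj⇒≢ G a ∘ injective x∈ y∈) (leaf-new y∈ xy))
    where
    open SaturatedStar star
    xy : Edge G (S ∖ ⁅ v ⁆) x y
    xy = ∈∖⁅⁆⁺ S (leaf∈ x∈) (≢-sym (adj⇒≢ G (leaf-adj x∈))) ,
         ∈∖⁅⁆⁺ S (leaf∈ y∈) (≢-sym (adj⇒≢ G (leaf-adj y∈))) , a

  degree-leaf : ∀ {v} → v ∈ˢ S → (star : SaturatedStar G S v) → let open SaturatedStar star in
                ∀ {x} → x ∈ leaves → degree G S x + length leaves ≤ size S
  degree-leaf {v} v∈ star {x} x∈ = begin
    degree G S x + length leaves                ≡⟨ length-++ (elems (S ∩ adj G x)) ⟨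
    length (elems (S ∩ adj G x) ++ leaves)      ≤⟨ length≤size S uniq sub ⟩
    size S                                      ∎
    where
    open SaturatedStar star
    open ≤-Reasoning
    uniq : Unique (elems (S ∩ adj G x) ++ leaves)
    uniq = Unique.++⁺ (elems-unique _) unique
      λ (p , q) → leaves-independent v∈ star x∈ q (proj₂ (∩⁻ S (adj G x) (∈-elems⁻ _ p)))
    sub : ∀ {i} → i ∈ elems (S ∩ adj G x) ++ leaves → i ∈ˢ S
    sub i∈ with ∈-++⁻ (elems (S ∩ adj G x)) i∈
    ... | inj₁ p = proj₁ (∩⁻ S (adj G x) (∈-elems⁻ _ p))
    ... | inj₂ q = leaf∈ q

degree<size : (G : ECGraph n) (S : VSet n) → ∀ {v} → v ∈ˢ S → degree G S v < size S
degree<size G S {v} v∈ = begin-strict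
  degree G S v         ≤⟨ size-mono (S ∩ adj G v) (S ∖ ⁅ v ⁆) sub ⟩
  size (S ∖ ⁅ v ⁆)     <⟨ ≤-refl ⟩
  suc (size (S ∖ ⁅ v ⁆)) ≡⟨ size-∖⁅⁆ S v∈ ⟨
  size S               ∎
  where
  open ≤-Reasoning
  sub : ∀ {i} → i ∈ˢ S ∩ adj G v → i ∈ˢ S ∖ ⁅ v ⁆
  sub p with ∩⁻ S (adj G v) p
  ... | i∈ , a = ∈∖⁅⁆⁺ S i∈ (≢-sym (adj⇒≢ G a))

minDegreeVertex : (G : ECGraph n) (S : VSet n) → NonEmpty S →
                  ∃ λ v → v ∈ˢ S × (∀ {u} → u ∈ˢ S → degree G S v ≤ degree G S u)
minDegreeVertex G S (w , w∈) = argmin d w (elems S) ,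
  argmin-all d {P = _∈ˢ S} w∈ (All.tabulate (∈-elems⁻ S)) ,
  λ u∈ → All.lookup (f[argmin]≤f[xs] {f = d} w (elems S)) (∈-elems⁺ S u∈)
  where d = degree G S

-- A leaf x of the star at v is non-adjacent to all leaves, so d(v) ≤ d(x) ≤ |S| − #leaves.
degree+leaves≤size : (G : ECGraph n) (S : VSet n) → RainbowFree G S → ∀ {v} → v ∈ˢ S →
  (∀ {u} → u ∈ˢ S → degree G S v ≤ degree G S u) → (star : SaturatedStar G S v) →
  degree G S v + length (SaturatedStar.leaves star) ≤ size S
degree+leaves≤size G S free {v} v∈ min star with SaturatedStar.leaves star in eq
... | [] = ≤-trans (≤-reflexive (+-identityʳ _)) (<⇒≤ (degree<size G S v∈))
... | x ∷ xs = ≤-trans (+-monoˡ-≤ _ (min (leaf∈ x∈)))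
                 (subst (λ l → degree G S x + length l ≤ size S) eq (degree-leaf G S free v∈ star x∈))
  where
  open SaturatedStar star
  x∈ : x ∈ leaves
  x∈ = subst (x ∈_) (sym eq) (here refl)

weight : ECGraph n → VSet n → ℕ
weight G S = eIn G S + cIn G S

weight-∖⁅⁆ : (G : ECGraph n) (S : VSet n) → ∀ {v} → v ∈ˢ S → (star : SaturatedStar G S v) →
  weight G S ≤ weight G (S ∖ ⁅ v ⁆) + (degree G S v + length (SaturatedStar.leaves star))
weight-∖⁅⁆ G S {v} v∈ star = begin
  eIn G S + cIn G S                                       ≤⟨ +-mono-≤ (≤-reflexive (eIn-∖⁅⁆ G S v∈)) bound ⟩
  (eIn G S′ + degree G S v) + (cIn G S′ + length leaves)  ≡⟨ interchange (eIn G S′) _ _ _ ⟩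
  weight G S′ + (degree G S v + length leaves)            ∎
  where
  open SaturatedStar star
  open ≤-Reasoning
  S′ = S ∖ ⁅ v ⁆
  interchange : ∀ a b c d → (a + b) + (c + d) ≡ (a + c) + (b + d)
  interchange = solve-∀

noEdges : (G : ECGraph n) (S : VSet n) → size S ≤ 1 → ∀ {i j} → ¬ Edge G S i j
noEdges G S small {i} {j} (i∈ , j∈ , a) = contradiction (≤-trans two small) λ { (s≤s ()) }
  where
  two : 2 ≤ size S
  two = length≤size S {i ∷ j ∷ []} ((adj⇒≢ G a ∷ []) ∷ [] ∷ [])
          λ { (here refl) → i∈ ; (there (here refl)) → j∈ }

weight-small : (G : ECGraph n) (S : VSet n) → size S ≤ 1 → weight G S ≡ 0
weight-small G S small = n≤0⇒n≡0 (+-mono-≤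
  (length-mono-unique {ys = []} (edgesIn-unique G S) λ p → contradiction (proj₁ (∈-edgesIn⁻ G S p)) (noEdges G S small))
  (cIn≤length G S {[]} λ e → contradiction e (noEdges G S small)))

size-∖⁅⁆-suc : ∀ (S : VSet n) {v m} → v ∈ˢ S → size S ≡ suc m → size (S ∖ ⁅ v ⁆) ≡ m
size-∖⁅⁆-suc S v∈ eq = suc-injective (trans (sym (size-∖⁅⁆ S v∈)) eq)

weight<tri : (G : ECGraph n) (S : VSet n) → ∀ m → size S ≡ suc m → RainbowFree G S → weight G S < tri (suc m)
weight<tri G S zero eq free = s≤s (≤-reflexive (weight-small G S (≤-reflexive eq)))
weight<tri G S (suc m) eq free with minDegreeVertex G S (size-nonempty S (≤-trans (s≤s z≤n) (≤-reflexive (sym eq))))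
... | v , v∈ , min = begin-strict
  weight G S                                     ≤⟨ weight-∖⁅⁆ G S v∈ star ⟩
  weight G S′ + (degree G S v + length leaves)   ≤⟨ +-monoʳ-≤ (weight G S′) (degree+leaves≤size G S free v∈ min star) ⟩
  weight G S′ + size S                           <⟨ +-monoˡ-< (size S) (weight<tri G S′ m (size-∖⁅⁆-suc S v∈ eq) free′) ⟩
  tri (suc m) + size S                           ≡⟨ +-comm (tri (suc m)) (size S) ⟩
  size S + tri (suc m)                           ≡⟨ cong (_+ tri (suc m)) eq ⟩
  tri (suc (suc m))                              ∎
  where
  open ≤-Reasoning
  S′ = S ∖ ⁅ v ⁆
  star = saturatedStar G S v
  open SaturatedStar star using (leaves)
  free′ : RainbowFree G S′
  free′ = rainbowFree-⊆ G (proj₁ ∘ ∈∖⁅⁆⁻ S) free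

tri-∖⁅⁆ : ∀ (S : VSet n) {v} → v ∈ˢ S → tri (size S) ≡ size S + tri (size (S ∖ ⁅ v ⁆))
tri-∖⁅⁆ S v∈ rewrite size-∖⁅⁆ S v∈ = refl

⊆-size≤⇒⊇ : ∀ (A B : VSet n) → (∀ {i} → i ∈ˢ A → i ∈ˢ B) → size B ≤ size A → ∀ {i} → i ∈ˢ B → i ∈ˢ A
⊆-size≤⇒⊇ A B sub B≤A {i} i∈B with A i in eq
... | true  = refl
... | false = contradiction (≤-trans (length≤size B {i ∷ elems A} (All.tabulate i≢ ∷ elems-unique A) sub′) B≤A) 1+n≰n
  where
  i≢ : ∀ {j} → j ∈ elems A → i ≢ j
  i≢ j∈ refl with trans (sym eq) (∈-elems⁻ A j∈)
  ... | ()
  sub′ : ∀ {j} → j ∈ i ∷ elems A → j ∈ˢ B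
  sub′ (here refl) = i∈B
  sub′ (there j∈)  = sub (∈-elems⁻ A j∈)

weight<tri-size : (G : ECGraph n) (S : VSet n) → NonEmpty S → RainbowFree G S → weight G S < tri (size S)
weight<tri-size G S ne free with size S in eq | size-pos S ne
... | suc m | _ = weight<tri G S m eq free

complete-⊆ : (G : ECGraph n) → ∀ {S R : VSet n} → (∀ {i} → i ∈ˢ R → i ∈ˢ S) → Complete G S → Complete G R
complete-⊆ G sub compl i j i∈ j∈ = compl i j (sub i∈) (sub j∈)

complete-degree : (G : ECGraph n) (S : VSet n) → Complete G S → ∀ {v} → v ∈ˢ S → degree G S v ≡ size (S ∖ ⁅ v ⁆)
complete-degree G S compl {v} v∈ = ≤-antisym
  (≤-pred (≤-trans (degree<size G S v∈) (≤-reflexive (size-∖⁅⁆ S v∈))))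
  (size-mono (S ∖ ⁅ v ⁆) (S ∩ adj G v) sub)
  where
  sub : ∀ {i} → i ∈ˢ S ∖ ⁅ v ⁆ → i ∈ˢ S ∩ adj G v
  sub p with ∈∖⁅⁆⁻ S p
  ... | i∈ , i≢v = ∧⁺ i∈ (compl v _ v∈ i∈ (≢-sym i≢v))

complete-eIn : (G : ECGraph n) (S : VSet n) → ∀ m → size S ≡ m → Complete G S → eIn G S + size S ≡ tri (size S)
complete-eIn G S zero eq compl rewrite eq =
  trans (+-identityʳ (eIn G S)) (m+n≡0⇒m≡0 (eIn G S) (weight-small G S (≤-trans (≤-reflexive eq) z≤n)))
complete-eIn G S (suc m) eq compl with size-nonempty S (≤-trans (s≤s z≤n) (≤-reflexive (sym eq)))
... | v , v∈ = begin
  eIn G S + size S                   ≡⟨ cong (_+ size S) (eIn-∖⁅⁆ G S v∈) ⟩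
  (eIn G S′ + degree G S v) + size S ≡⟨ cong (λ d → (eIn G S′ + d) + size S) (complete-degree G S compl v∈) ⟩
  (eIn G S′ + size S′) + size S      ≡⟨ cong (_+ size S) (complete-eIn G S′ m (size-∖⁅⁆-suc S v∈ eq) compl′) ⟩
  tri (size S′) + size S             ≡⟨ +-comm (tri (size S′)) (size S) ⟩
  size S + tri (size S′)             ≡⟨ tri-∖⁅⁆ S v∈ ⟨
  tri (size S)                       ∎
  where
  open ≡-Reasoning
  S′ = S ∖ ⁅ v ⁆
  compl′ : Complete G S′
  compl′ = complete-⊆ G (proj₁ ∘ ∈∖⁅⁆⁻ S) compl

complete-weight : (G : ECGraph n) (S : VSet n) → Complete G S → weight G S + size S ≡ tri (size S) + cIn G S
complete-weight G S compl = begin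
  (eIn G S + cIn G S) + size S   ≡⟨ shuffle (eIn G S) (cIn G S) (size S) ⟩
  (eIn G S + size S) + cIn G S   ≡⟨ cong (_+ cIn G S) (complete-eIn G S (size S) refl compl) ⟩
  tri (size S) + cIn G S         ∎
  where
  open ≡-Reasoning
  shuffle : ∀ a b c → (a + b) + c ≡ (a + c) + b
  shuffle = solve-∀

complete-cIn<size : (G : ECGraph n) (S : VSet n) → Complete G S → NonEmpty S → RainbowFree G S → cIn G S < size S
complete-cIn<size G S compl ne free = +-cancelˡ-< (tri (size S)) _ _ (begin-strict
  tri (size S) + cIn G S   ≡⟨ complete-weight G S compl ⟨
  weight G S + size S      <⟨ +-monoˡ-< (size S) (weight<tri-size G S ne free) ⟩
  tri (size S) + size S    ∎)
  where open ≤-Reasoning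

complete-heavy⁺ : (G : ECGraph n) (S : VSet n) → Complete G S →
                  size S ≤ suc (cIn G S) → tri (size S) ≤ suc (weight G S)
complete-heavy⁺ G S compl h = +-cancelʳ-≤ (cIn G S) _ _ (begin
  tri (size S) + cIn G S         ≡⟨ complete-weight G S compl ⟨
  weight G S + size S            ≤⟨ +-monoʳ-≤ (weight G S) h ⟩
  weight G S + suc (cIn G S)     ≡⟨ +-suc (weight G S) (cIn G S) ⟩
  suc (weight G S) + cIn G S     ∎)
  where open ≤-Reasoning

complete-heavy⁻ : (G : ECGraph n) (S : VSet n) → Complete G S →
                  tri (size S) ≤ suc (weight G S) → size S ≤ suc (cIn G S)
complete-heavy⁻ G S compl h = +-cancelˡ-≤ (tri (size S)) _ _ (begin
  tri (size S) + size S          ≤⟨ +-monoˡ-≤ (size S) h ⟩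
  suc (weight G S + size S)      ≡⟨ cong suc (complete-weight G S compl) ⟩
  suc (tri (size S) + cIn G S)   ≡⟨ +-suc (tri (size S)) (cIn G S) ⟨
  tri (size S) + suc (cIn G S)   ∎)
  where open ≤-Reasoning

isG0-complete : (G : ECGraph n) (S : VSet n) → IsG0 G S → Complete G S
isG0-complete G S (g0-split _ compl _ _ _ _ _ _ _ _ _) = compl
isG0-complete G S (g0-K1 eq) i j i∈ j∈ i≢j = contradiction
  (≤-trans (length≤size S {i ∷ j ∷ []} ((i≢j ∷ []) ∷ [] ∷ [])
              λ { (here refl) → i∈ ; (there (here refl)) → j∈ })
           (≤-reflexive eq))
  λ { (s≤s ()) }

bipartition-swap : (S A B : VSet n) → Bipartition S A B → Bipartition S B A
bipartition-swap S A B (cover , subA , subB , disj) =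
  (λ i → Sum.swap ∘ cover i) , subB , subA , λ i p q → disj i q p

mono-swap : (G : ECGraph n) (S A B : VSet n) → Complete G S → Bipartition S A B → Mono G A B → Mono G B A
mono-swap G S A B compl (_ , subA , subB , disj) (κ , mono) = κ , λ i j i∈ j∈ →
  trans (col-sym G i j (compl i j (subB i i∈) (subA j j∈) λ { refl → disj i j∈ i∈ })) (mono j i j∈ i∈)

Heavy⇒G0 : ECGraph n → VSet n → Set
Heavy⇒G0 G S = NonEmpty S → RainbowFree G S → tri (size S) ≤ suc (weight G S) → IsG0 G S

module _ (G : ECGraph n) (S : VSet n) (IH : ∀ V → size V < size S → Heavy⇒G0 G V)
         (compl : Complete G S) (free : RainbowFree G S) (h : size S ≤ suc (cIn G S)) where

  -- A part has fewer colours than vertices; since c(S) = |S| − 1 and the crossing edges add one colour,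
  -- both parts attain this bound.
  split⇒G0 : ∀ V₁ V₂ → Bipartition S V₁ V₂ → NonEmpty V₁ → NonEmpty V₂ → Mono G V₁ V₂ → IsG0 G S
  split⇒G0 V₁ V₂ bip@(_ , sub₁ , sub₂ , _) ne₁ ne₂ mono =
    g0-split 2≤size compl cIn≡ V₁ V₂ bip ne₁ ne₂ mono
      (IH V₁ size₁< ne₁ free₁ (complete-heavy⁺ G V₁ compl₁ (+-cancelʳ-≤ (size V₂) _ _ (begin
        size V₁ + size V₂                ≤⟨ total ⟩
        suc (cIn G V₁) + suc (cIn G V₂)  ≤⟨ +-monoʳ-≤ (suc (cIn G V₁)) c₂< ⟩
        suc (cIn G V₁) + size V₂         ∎))))
      (IH V₂ size₂< ne₂ free₂ (complete-heavy⁺ G V₂ compl₂ (+-cancelˡ-≤ (size V₁) _ _ (begin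
        size V₁ + size V₂                ≤⟨ total ⟩
        suc (cIn G V₁) + suc (cIn G V₂)  ≤⟨ +-monoˡ-≤ (suc (cIn G V₂)) c₁< ⟩
        size V₁ + suc (cIn G V₂)         ∎))))
    where
    open ≤-Reasoning
    free₁ = rainbowFree-⊆ G (λ {i} → sub₁ i) free
    free₂ = rainbowFree-⊆ G (λ {i} → sub₂ i) free
    compl₁ = complete-⊆ G {S} {V₁} (λ {i} → sub₁ i) compl
    compl₂ = complete-⊆ G {S} {V₂} (λ {i} → sub₂ i) compl
    c₁< = complete-cIn<size G V₁ compl₁ ne₁ free₁
    c₂< = complete-cIn<size G V₂ compl₂ ne₂ free₂
    size≡ : size S ≡ size V₁ + size V₂
    size≡ = size-bipartition S V₁ V₂ bip
    2≤size : 2 ≤ size S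
    2≤size = ≤-trans (+-mono-≤ (size-pos V₁ ne₁) (size-pos V₂ ne₂)) (≤-reflexive (sym size≡))
    size₁< : size V₁ < size S
    size₁< = begin-strict
      size V₁            ≡⟨ +-identityʳ (size V₁) ⟨
      size V₁ + 0        <⟨ +-monoʳ-< (size V₁) (size-pos V₂ ne₂) ⟩
      size V₁ + size V₂  ≡⟨ size≡ ⟨
      size S             ∎
    size₂< : size V₂ < size S
    size₂< = begin-strict
      size V₂            <⟨ +-monoˡ-< (size V₂) (size-pos V₁ ne₁) ⟩
      size V₁ + size V₂  ≡⟨ size≡ ⟨
      size S             ∎
    cIn≡ : cIn G S ≡ size S ∸ 1
    cIn≡ = cong (_∸ 1) (≤-antisym (complete-cIn<size G S compl (proj₁ ne₁ , sub₁ _ (proj₂ ne₁)) free) h)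
    total : size V₁ + size V₂ ≤ suc (cIn G V₁) + suc (cIn G V₂)
    total = begin
      size V₁ + size V₂                ≡⟨ size≡ ⟨
      size S                           ≤⟨ h ⟩
      suc (cIn G S)                    ≤⟨ s≤s (cIn-bipartition G S V₁ V₂ bip mono) ⟩
      suc (suc (cIn G V₁ + cIn G V₂))  ≡⟨ +-suc (suc (cIn G V₁)) (cIn G V₂) ⟨
      suc (cIn G V₁) + suc (cIn G V₂)  ∎

  module _ {v x : Fin n} (v∈ : v ∈ˢ S) (x∈ : x ∈ˢ S ∖ ⁅ v ⁆)
           (new : ∀ {i j} → Edge G (S ∖ ⁅ v ⁆) i j → col G i j ≢ col G v x) where

    private
      S′ = S ∖ ⁅ v ⁆
      red = col G v x

      Red : VSet n
      Red i = does (col G v i ≟ red)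

      red⁻ : ∀ {i} → i ∈ˢ Red → col G v i ≡ red
      red⁻ {i} = does⁻ (col G v i ≟ red)

      red⁺ : ∀ {i} → col G v i ≡ red → i ∈ˢ Red
      red⁺ {i} = dec-true (col G v i ≟ red)

    twin : ∀ {r w} → r ∈ˢ S′ → r ∈ˢ Red → w ∈ˢ S′ → ¬ w ∈ˢ Red → col G r w ≡ col G v w
    twin {r} {w} r∈ rr w∈ wr with col G r w ≟ col G v w | ∈∖⁅⁆⁻ S r∈ | ∈∖⁅⁆⁻ S w∈
    ... | yes eq | _ | _ = eq
    ... | no neq | r∈S , r≢v | w∈S , w≢v = contradiction
      (rainbow (compl v r v∈ r∈S (≢-sym r≢v)) rw (compl v w v∈ w∈S (≢-sym w≢v))
        (λ eq → new (r∈ , w∈ , rw) (trans (sym eq) (red⁻ rr)))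
        (λ eq → wr (red⁺ (trans (sym eq) (red⁻ rr))))
        neq)
      (free v∈ r∈S w∈S)
      where
      rw : adj G r w ≡ true
      rw = compl r w r∈S w∈S λ { refl → wr rr }

    private
      splitBy : (P : VSet n) → v ∈ˢ P → NonEmpty (S ∖ P) → (κ : ℕ) →
                (∀ {i j} → i ∈ˢ S ∩ P → j ∈ˢ S′ → ¬ j ∈ˢ P → col G i j ≡ κ) → IsG0 G S
      splitBy P v∈P ne κ mono = split⇒G0 (S ∩ P) (S ∖ P) (∩∖-bipartition S P) (v , ∧⁺ v∈ v∈P) ne
        (κ , λ i j i∈ j∈ → let (j∈S , j∉P) = ∖⁻ S P j∈ in
               mono i∈ (∈∖⁅⁆⁺ S j∈S λ { refl → j∉P v∈P }) j∉P)

      oneSided : (A B : VSet n) → Bipartition S′ A B → NonEmpty B → Mono G A B →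
                 (∀ {i} → ¬ i ∈ˢ B ∩ Red) → IsG0 G S
      oneSided A B (cover , subA , subB , disj) (b , b∈) (κ , mono) noRed =
        splitBy P (∨⁺ˡ (v∈⁅v⁆ v)) (b , ∖⁺ S P (proj₁ (∈∖⁅⁆⁻ S (subB b b∈))) b∉P) κ
          λ i∈ → monoP (∨⁻ (proj₂ (∩⁻ S P i∈)))
        where
        P = ⁅ v ⁆ ∪ A
        b∉P : ¬ b ∈ˢ P
        b∉P b∈P with ∨⁻ b∈P
        ... | inj₁ b≡v = proj₂ (∈∖⁅⁆⁻ S (subB b b∈)) (∈⁅⁆⁻ {v = v} b≡v)
        ... | inj₂ b∈A = disj b b∈A b∈
        notRed : ∀ {i} → i ∈ˢ B → ¬ i ∈ˢ Red
        notRed i∈ r = noRed (∧⁺ i∈ r)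
        x∈A : x ∈ˢ A
        x∈A with cover x x∈
        ... | inj₁ p = p
        ... | inj₂ p = contradiction (red⁺ refl) (notRed p)
        monoP : ∀ {i j} → i ∈ˢ ⁅ v ⁆ ⊎ i ∈ˢ A → j ∈ˢ S′ → ¬ j ∈ˢ P → col G i j ≡ κ
        monoP {i} {j} i∈ j∈ j∉ with cover j j∈
        ... | inj₁ j∈A = contradiction (∨⁺ʳ j∈A) j∉
        monoP {i} {j} (inj₂ i∈A) j∈ j∉ | inj₂ j∈B = mono i j i∈A j∈B
        monoP {i} {j} (inj₁ i≡v) j∈ j∉ | inj₂ j∈B with ∈⁅⁆⁻ {i = i} {v} i≡v
        ... | refl = trans (sym (twin x∈ (red⁺ refl) j∈ (notRed j∈B))) (mono x j x∈A j∈B)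

      twoSided : (A B : VSet n) → Bipartition S′ A B → Mono G A B → Mono G B A →
                 NonEmpty (S′ ∖ Red) → NonEmpty (A ∩ Red) → NonEmpty (B ∩ Red) → IsG0 G S
      twoSided A B (cover , subA , subB , disj) (κ , mono) (κ′ , mono′) (w , w∈) (a , a∈) (b , b∈)
        with ∩⁻ A Red a∈ | ∩⁻ B Red b∈ | ∖⁻ S′ Red w∈
      ... | a∈A , ar | b∈B , br | w∈S′ , wr =
        splitBy P (∨⁺ˡ (v∈⁅v⁆ v)) (w , ∖⁺ S P (proj₁ (∈∖⁅⁆⁻ S w∈S′)) w∉P) κ
          λ i∈ j∈ j∉ → monoP (proj₁ (∩⁻ S P i∈)) (∨⁻ (proj₂ (∩⁻ S P i∈))) j∈ (j∉ ∘ ∨⁺ʳ)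
        where
        P = ⁅ v ⁆ ∪ Red
        w∉P : ¬ w ∈ˢ P
        w∉P w∈P with ∨⁻ w∈P
        ... | inj₁ w≡v = proj₂ (∈∖⁅⁆⁻ S w∈S′) (∈⁅⁆⁻ {v = v} w≡v)
        ... | inj₂ p   = wr p
        κ′≡κ : κ′ ≡ κ
        κ′≡κ = trans (sym (mono′ b a b∈B a∈A)) (trans (col-sym G b a ba) (mono a b a∈A b∈B))
          where
          ba : adj G b a ≡ true
          ba = compl b a (proj₁ (∈∖⁅⁆⁻ S (subB b b∈B))) (proj₁ (∈∖⁅⁆⁻ S (subA a a∈A))) λ { refl → disj _ a∈A b∈B }
        toV : ∀ {j} → j ∈ˢ S′ → ¬ j ∈ˢ Red → col G v j ≡ κ
        toV {j} j∈ jr with cover j j∈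
        ... | inj₁ j∈A = trans (sym (twin (subB b b∈B) br j∈ jr)) (trans (mono′ b j b∈B j∈A) κ′≡κ)
        ... | inj₂ j∈B = trans (sym (twin (subA a a∈A) ar j∈ jr)) (mono a j a∈A j∈B)
        monoP : ∀ {i j} → i ∈ˢ S → i ∈ˢ ⁅ v ⁆ ⊎ i ∈ˢ Red → j ∈ˢ S′ → ¬ j ∈ˢ Red → col G i j ≡ κ
        monoP {i} {j} i∈ i∈P j∈ jr with i Fin.≟ v
        ... | yes refl = toV j∈ jr
        monoP {i} {j} i∈ (inj₁ ()) j∈ jr | no i≢v
        monoP {i} {j} i∈ (inj₂ ir) j∈ jr | no i≢v = trans (twin (∈∖⁅⁆⁺ S i∈ i≢v) ir j∈ jr) (toV j∈ jr)

    -- By twin, the red neighbours of v either lie on one side of the split of S′, which v can join, or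
    -- meet both sides, and then {v} ∪ Red is joined to the rest in the colour of that split.
    extend⇒G0 : IsG0 G S′ → IsG0 G S
    extend⇒G0 g with find-∈ˢ (S′ ∖ Red)
    ... | inj₂ none = splitBy ⁅ v ⁆ (v∈⁅v⁆ v) (x , x∈) red
        λ i∈ j∈ _ → mono (∈⁅⁆⁻ {v = v} (proj₂ (∩⁻ S ⁅ v ⁆ i∈))) j∈
      where
      mono : ∀ {i j} → i ≡ v → j ∈ˢ S′ → col G i j ≡ red
      mono {j = j} refl j∈ with col G v j ≟ red
      ... | yes p = p
      ... | no ¬p = contradiction (∖⁺ S′ Red j∈ (¬p ∘ red⁻)) none
    extend⇒G0 (g0-K1 eq) | inj₁ (w , w∈) with ∖⁻ S′ Red w∈
    ... | w∈S′ , wr = contradiction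
      (x∈ , w∈S′ , isG0-complete G S′ (g0-K1 eq) x w x∈ w∈S′ λ { refl → wr (red⁺ refl) })
      (noEdges G S′ (≤-reflexive eq))
    extend⇒G0 (g0-split _ compl′ _ A B bip neA neB mono _ _) | inj₁ nonRed
      with find-∈ˢ (A ∩ Red) | find-∈ˢ (B ∩ Red)
    ... | inj₁ a | inj₁ b = twoSided A B bip mono (mono-swap G S′ A B compl′ bip mono) nonRed a b
    ... | _ | inj₂ noB = oneSided A B bip neB mono noB
    ... | inj₂ noA | _ = oneSided B A (bipartition-swap S′ A B bip) neA (mono-swap G S′ A B compl′ bip mono) noA

heavy⇒G0 : ∀ k (G : ECGraph n) (S : VSet n) → size S ≤ k → Heavy⇒G0 G S
heavy⇒G0 zero G S S≤k ne = contradiction (≤-trans (size-pos S ne) S≤k) λ ()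
heavy⇒G0 (suc k) G S S≤k ne free heavy with size S ≤? 1
... | yes S≤1 = g0-K1 (≤-antisym S≤1 (size-pos S ne))
... | no S≰1 with minDegreeVertex G S ne
... | v , v∈ , min = finish leaves refl
  where
  open ≤-Reasoning
  S′ = S ∖ ⁅ v ⁆
  star = saturatedStar G S v
  open SaturatedStar star
  d = degree G S v
  l = length leaves

  IH : ∀ V → size V < size S → Heavy⇒G0 G V
  IH V V<S = heavy⇒G0 k G V (≤-pred (≤-trans V<S S≤k))

  ne′ : NonEmpty S′
  ne′ = size-nonempty S′ (≤-pred (≤-trans (≰⇒> S≰1) (≤-reflexive (size-∖⁅⁆ S v∈))))

  free′ : RainbowFree G S′
  free′ = rainbowFree-⊆ G (proj₁ ∘ ∈∖⁅⁆⁻ S) free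

  heavy′ : tri (size S′) ≤ suc (weight G S′)
  heavy′ = +-cancelˡ-≤ (size S) _ _ (begin
    size S + tri (size S′)        ≡⟨ tri-∖⁅⁆ S v∈ ⟨
    tri (size S)                  ≤⟨ heavy ⟩
    suc (weight G S)              ≤⟨ s≤s (weight-∖⁅⁆ G S v∈ star) ⟩
    suc (weight G S′) + (d + l)   ≤⟨ +-monoʳ-≤ (suc (weight G S′)) (degree+leaves≤size G S free v∈ min star) ⟩
    suc (weight G S′) + size S    ≡⟨ +-comm (suc (weight G S′)) (size S) ⟩
    size S + suc (weight G S′)    ∎)

  size≤d+l : size S ≤ d + l
  size≤d+l = +-cancelʳ-≤ (tri (size S′)) _ _ (begin
    size S + tri (size S′)        ≡⟨ tri-∖⁅⁆ S v∈ ⟨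
    tri (size S)                  ≤⟨ heavy ⟩
    suc (weight G S)              ≤⟨ s≤s (weight-∖⁅⁆ G S v∈ star) ⟩
    suc (weight G S′) + (d + l)   ≤⟨ +-monoˡ-≤ (d + l) (weight<tri-size G S′ ne′ free′) ⟩
    tri (size S′) + (d + l)       ≡⟨ +-comm (tri (size S′)) (d + l) ⟩
    (d + l) + tri (size S′)       ∎)

  g′ : IsG0 G S′
  g′ = IH S′ (≤-reflexive (sym (size-∖⁅⁆ S v∈))) ne′ free′ heavy′

  leaf∈S′ : ∀ {x} → x ∈ leaves → x ∈ˢ S′
  leaf∈S′ x∈ = ∈∖⁅⁆⁺ S (leaf∈ x∈) (≢-sym (adj⇒≢ G (leaf-adj x∈)))

  finish : ∀ xs → leaves ≡ xs → IsG0 G S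
  finish [] eq = contradiction
    (≤-trans size≤d+l (≤-reflexive (trans (cong (λ xs → d + length xs) eq) (+-identityʳ d))))
    (<⇒≱ (degree<size G S v∈))
  finish (x ∷ y ∷ xs) eq = contradiction (isG0-complete G S′ g′ x y (leaf∈S′ x∈) (leaf∈S′ y∈) x≢y)
                                         (leaves-independent G S free v∈ star x∈ y∈)
    where
    x∈ : x ∈ leaves
    x∈ = subst (x ∈_) (sym eq) (here refl)
    y∈ : y ∈ leaves
    y∈ = subst (y ∈_) (sym eq) (there (here refl))
    x≢y : x ≢ y
    x≢y with subst Unique eq unique
    ... | (p ∷ _) ∷ _ = p
  finish (x ∷ []) eq =
    extend⇒G0 G S IH compl free (complete-heavy⁻ G S compl heavy) v∈ (leaf∈S′ x∈) (leaf-new x∈) g′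
    where
    x∈ : x ∈ leaves
    x∈ = subst (x ∈_) (sym eq) (here refl)
    toAll : ∀ {i} → i ∈ˢ S′ → i ∈ˢ S ∩ adj G v
    toAll = ⊆-size≤⇒⊇ (S ∩ adj G v) S′
      (λ p → let (i∈ , a) = ∩⁻ S (adj G v) p in ∈∖⁅⁆⁺ S i∈ (≢-sym (adj⇒≢ G a)))
      (≤-pred (begin
        suc (size S′)          ≡⟨ size-∖⁅⁆ S v∈ ⟨
        size S                 ≤⟨ size≤d+l ⟩
        d + l                  ≡⟨ cong (λ xs → d + length xs) eq ⟩
        d + 1                  ≡⟨ +-comm d 1 ⟩
        suc d                  ∎))
    compl : Complete G S
    compl i j i∈ j∈ i≢j with i Fin.≟ v | j Fin.≟ v
    ... | yes refl | _ = proj₂ (∩⁻ S (adj G v) (toAll (∈∖⁅⁆⁺ S j∈ (≢-sym i≢j))))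
    ... | no _ | yes refl = adj-flip G (proj₂ (∩⁻ S (adj G v) (toAll (∈∖⁅⁆⁺ S i∈ i≢j))))
    ... | no i≢v | no j≢v = isG0-complete G S′ g′ i j (∈∖⁅⁆⁺ S i∈ i≢v) (∈∖⁅⁆⁺ S j∈ j≢v) i≢j

-- Graphs with exactly one rainbow triangle

Pair : Fin n → Fin n → Fin n → Fin n → Set
Pair p q i j = (i ≡ p × j ≡ q) ⊎ (i ≡ q × j ≡ p)

pair? : (p q i j : Fin n) → Dec (Pair p q i j)
pair? p q i j = (i Fin.≟ p ×-dec j Fin.≟ q) ⊎-dec (i Fin.≟ q ×-dec j Fin.≟ p)

pair-flip : ∀ {p q i j : Fin n} → Pair p q i j → Pair p q j i
pair-flip (inj₁ (e , f)) = inj₂ (f , e)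
pair-flip (inj₂ (e , f)) = inj₁ (f , e)

does-pair?-sym : (p q i j : Fin n) → does (pair? p q i j) ≡ does (pair? p q j i)
does-pair?-sym p q i j = does-⇔ (mk⇔ pair-flip pair-flip) (pair? p q i j) (pair? p q j i)

pair⇒∈ : ∀ {p q i j : Fin n} {xs} → i ∈ xs → j ∈ xs → Pair p q i j → p ∈ xs × q ∈ xs
pair⇒∈ i∈ j∈ (inj₁ (refl , refl)) = i∈ , j∈
pair⇒∈ i∈ j∈ (inj₂ (refl , refl)) = j∈ , i∈

pair⇒∈′ : ∀ {p q i j : Fin n} {xs} → p ∈ xs → q ∈ xs → Pair p q i j → i ∈ xs × j ∈ xs
pair⇒∈′ p∈ q∈ (inj₁ (refl , refl)) = p∈ , q∈
pair⇒∈′ p∈ q∈ (inj₂ (refl , refl)) = q∈ , p∈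

pair-col : (G : ECGraph n) → ∀ {p q i j} → adj G p q ≡ true → Pair p q i j → col G i j ≡ col G p q
pair-col G pq (inj₁ (refl , refl)) = refl
pair-col G pq (inj₂ (refl , refl)) = sym (col-sym G _ _ pq)

rainbow-reorder : (G : ECGraph n) → ∀ {a b c p q} → Rainbow G a b c →
  p ∈ a ∷ b ∷ c ∷ [] → q ∈ a ∷ b ∷ c ∷ [] → p ≢ q → ∃ λ w → Rainbow G p q w
rainbow-reorder G t (here refl) (here refl) p≢q = contradiction refl p≢q
rainbow-reorder G t (here refl) (there (here refl)) _ = _ , t
rainbow-reorder G t (here refl) (there (there (here refl))) _ =
  _ , rainbow-swap G (rainbow-rotate G (rainbow-rotate G t))
rainbow-reorder G t (there (here refl)) (here refl) _ = _ , rainbow-swap G t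
rainbow-reorder G t (there (here refl)) (there (here refl)) p≢q = contradiction refl p≢q
rainbow-reorder G t (there (here refl)) (there (there (here refl))) _ = _ , rainbow-rotate G t
rainbow-reorder G t (there (there (here refl))) (here refl) _ = _ , rainbow-rotate G (rainbow-rotate G t)
rainbow-reorder G t (there (there (here refl))) (there (here refl)) _ = _ , rainbow-swap G (rainbow-rotate G t)
rainbow-reorder G t (there (there (here refl))) (there (there (here refl))) p≢q = contradiction refl p≢q

deleteEdge : ECGraph n → Fin n → Fin n → ECGraph n
deleteEdge G p q = record
  { adj     = λ i j → adj G i j ∧ not (does (pair? p q i j))
  ; adj-sym = λ i j → cong₂ (λ a b → a ∧ not b) (adj-sym G i j) (does-pair?-sym p q i j)
  ; adj-irr = λ i → cong (_∧ not (does (pair? p q i i))) (adj-irr G i)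
  ; col     = col G
  ; col-sym = λ i j e → col-sym G i j (proj₁ (∧⁻ e))
  }

recolour : ECGraph n → Fin n → Fin n → ℕ → ECGraph n
recolour G p q κ = record
  { adj     = adj G
  ; adj-sym = adj-sym G
  ; adj-irr = adj-irr G
  ; col     = λ i j → if does (pair? p q i j) then κ else col G i j
  ; col-sym = λ i j e → cong₂ (if_then κ else_) (does-pair?-sym p q i j) (col-sym G i j e)
  }

recolour-pair : (G : ECGraph n) → ∀ {p q κ i j} → Pair p q i j → col (recolour G p q κ) i j ≡ κ
recolour-pair G {p} {q} {i = i} {j} pr rewrite dec-true (pair? p q i j) pr = refl

recolour-other : (G : ECGraph n) → ∀ {p q κ i j} → ¬ Pair p q i j → col (recolour G p q κ) i j ≡ col G i j
recolour-other G {p} {q} {i = i} {j} ¬pr rewrite dec-false (pair? p q i j) ¬pr = refl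

cIn-cong-≤ : (G H : ECGraph n) (S : VSet n) → (∀ {i j} → adj G i j ≡ adj H i j) →
  (∀ {i j} → i ∈ˢ S → j ∈ˢ S → col G i j ≡ col H i j) → cIn G S ≤ cIn H S
cIn-cong-≤ G H S adj≡ col≡ = cIn≤length G S λ (i∈ , j∈ , a) →
  subst (_∈ palette H S) (sym (col≡ i∈ j∈)) (∈-palette⁺ H S (i∈ , j∈ , trans (sym adj≡) a))

isG0-cong : (G H : ECGraph n) (S : VSet n) → (∀ {i j} → adj G i j ≡ adj H i j) →
  (∀ {i j} → i ∈ˢ S → j ∈ˢ S → col G i j ≡ col H i j) → IsG0 G S → IsG0 H S
isG0-cong G H S adj≡ col≡ (g0-K1 eq) = g0-K1 eq
isG0-cong G H S adj≡ col≡ (g0-split 2≤ compl cIn≡ A B bip@(_ , subA , subB , _) neA neB (κ , mono) gA gB) =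
  g0-split 2≤ (λ i j i∈ j∈ i≢j → trans (sym adj≡) (compl i j i∈ j∈ i≢j))
    (trans (≤-antisym (cIn-cong-≤ H G S (sym adj≡) (λ i∈ j∈ → sym (col≡ i∈ j∈))) (cIn-cong-≤ G H S adj≡ col≡)) cIn≡)
    A B bip neA neB (κ , λ i j i∈ j∈ → trans (sym (col≡ (subA i i∈) (subB j j∈))) (mono i j i∈ j∈))
    (isG0-cong G H A adj≡ (λ i∈ j∈ → col≡ (subA _ i∈) (subA _ j∈)) gA)
    (isG0-cong G H B adj≡ (λ i∈ j∈ → col≡ (subB _ i∈) (subB _ j∈)) gB)

module UniqueTriangle (G : ECGraph n) {x y z : Fin n} (xyz : Rainbow G x y z)
  (only : ∀ {a b c} → Rainbow G a b c → (x ∷ y ∷ z ∷ []) ⊆ (a ∷ b ∷ c ∷ []))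
  (heavy : tri (size (full {n})) ≤ weight G full) where

  open Rainbow xyz renaming (ab to xy; bc to yz; ac to xz; ab≢bc to xy≢yz; ab≢ac to xy≢xz; bc≢ac to yz≢xz)

  corners : List (Fin n)
  corners = x ∷ y ∷ z ∷ []

  x∈ : x ∈ corners
  x∈ = here refl
  y∈ : y ∈ corners
  y∈ = there (here refl)
  z∈ : z ∈ corners
  z∈ = there (there (here refl))

  x≢y : x ≢ y
  x≢y = adj⇒≢ G xy
  y≢z : y ≢ z
  y≢z = adj⇒≢ G yz
  x≢z : x ≢ z
  x≢z = adj⇒≢ G xz

  corners-adj : ∀ {p q} → p ∈ corners → q ∈ corners → p ≢ q → adj G p q ≡ true
  corners-adj p∈ q∈ p≢q = Rainbow.ab (proj₂ (rainbow-reorder G xyz p∈ q∈ p≢q))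

  ne-full : NonEmpty (full {n})
  ne-full = x , refl

  -- Were another edge ij coloured like pq, deleting pq would leave a rainbow-free graph of weight at
  -- least tri n ∸ 1, hence a complete one.
  colour-unique : ∀ {p q} → p ∈ corners → q ∈ corners → p ≢ q →
                  ∀ {i j} → adj G i j ≡ true → col G i j ≡ col G p q → Pair p q i j
  colour-unique {p} {q} p∈ q∈ p≢q {i} {j} ij eq with pair? p q i j
  ... | yes pr = pr
  ... | no ¬pr = contradiction (isG0-complete H full g0 p q refl refl p≢q) pq∉H
    where
    H = deleteEdge G p q
    keep : ∀ {k l} → adj G k l ≡ true → ¬ Pair p q k l → adj H k l ≡ true
    keep {k} {l} kl ¬kl = ∧⁺ kl (cong not (dec-false (pair? p q k l) ¬kl))
    pq∉H : ¬ adj H p q ≡ true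
    pq∉H e = not⁻ {does (pair? p q p q)} (proj₂ (∧⁻ {adj G p q} e)) (dec-true (pair? p q p q) (inj₁ (refl , refl)))
    free : RainbowFree H full
    free _ _ _ t@(rainbow ab bc ac f g h) = pq∉H (Rainbow.ab (proj₂ (rainbow-reorder H t (sub p∈) (sub q∈) p≢q)))
      where sub = only (rainbow (proj₁ (∧⁻ ab)) (proj₁ (∧⁻ bc)) (proj₁ (∧⁻ ac)) f g h)
    edges : edgesIn G full ⊆ ordered p q ∷ edgesIn H full
    edges {k , l} kl∈ with ∈-edgesIn⁻ G full kl∈ | pair? p q k l
    ... | (_ , _ , kl) , k<l | no ¬kl = there (∈-edgesIn⁺ H full (refl , refl , keep kl ¬kl) k<l)
    ... | _ , k<l | yes (inj₁ (refl , refl)) = here (sym (ordered-< k<l))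
    ... | _ , k<l | yes (inj₂ (refl , refl)) = here (sym (ordered-> k<l))
    cols : ∀ {k l} → Edge G full k l → col G k l ∈ palette H full
    cols {k} {l} (_ , _ , kl) with pair? p q k l
    ... | no ¬kl = ∈-palette⁺ H full (refl , refl , keep kl ¬kl)
    ... | yes pr = subst (_∈ palette H full) (trans eq (sym (pair-col G (corners-adj p∈ q∈ p≢q) pr)))
                     (∈-palette⁺ H full (refl , refl , keep ij ¬pr))
    g0 : IsG0 H full
    g0 = heavy⇒G0 _ H full ≤-refl ne-full free (≤-trans heavy
           (+-mono-≤ (length-mono-unique (edgesIn-unique G full) edges) (cIn≤length G full cols)))

  R : ECGraph n
  R = recolour G x y (col G x z)

  R-xy : ∀ {i j} → Pair x y i j → col R i j ≡ col G x z
  R-xy = recolour-pair G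

  R-other : ∀ {i j} → ¬ Pair x y i j → col R i j ≡ col G i j
  R-other = recolour-other G

  R-rainbowFree : RainbowFree R full
  R-rainbowFree {a} {b} {c} _ _ _ t@(rainbow ab bc ac f g h) =
    noXY (proj₂ (rainbow-reorder R t (proj₁ xy∈) (proj₂ xy∈) x≢y))
    where
    xy∈ : x ∈ a ∷ b ∷ c ∷ [] × y ∈ a ∷ b ∷ c ∷ []
    xy∈ with pair? x y a b | pair? x y b c | pair? x y a c
    ... | yes p | _ | _ = pair⇒∈ (here refl) (there (here refl)) p
    ... | no _ | yes p | _ = pair⇒∈ (there (here refl)) (there (there (here refl))) p
    ... | no _ | no _ | yes p = pair⇒∈ (here refl) (there (there (here refl))) p
    ... | no ¬ab | no ¬bc | no ¬ac = sub x∈ , sub y∈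
      where
      sub = only {a} {b} {c} (rainbow ab bc ac
        (λ e → f (trans (R-other ¬ab) (trans e (sym (R-other ¬bc)))))
        (λ e → g (trans (R-other ¬ab) (trans e (sym (R-other ¬ac)))))
        (λ e → h (trans (R-other ¬bc) (trans e (sym (R-other ¬ac))))))
    noXY : ∀ {w} → ¬ Rainbow R x y w
    noXY {w} (rainbow _ yw xw f g h) with w Fin.≟ z
    ... | yes refl = g (trans (R-xy (inj₁ (refl , refl))) (sym (R-other ¬xz)))
      where
      ¬xz : ¬ Pair x y x z
      ¬xz (inj₁ (_ , z≡y)) = y≢z (sym z≡y)
      ¬xz (inj₂ (x≡y , _)) = x≢y x≡y
    ... | no w≢z = z∉ (only (rainbow xy yw xw
        (λ e → ¬yw (colour-unique x∈ y∈ x≢y yw (sym e)))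
        (λ e → ¬xw (colour-unique x∈ y∈ x≢y xw (sym e)))
        (λ e → h (trans (R-other ¬yw) (trans e (sym (R-other ¬xw)))))) z∈)
      where
      ¬yw : ¬ Pair x y y w
      ¬yw (inj₁ (y≡x , _)) = x≢y (sym y≡x)
      ¬yw (inj₂ (_ , w≡x)) = adj⇒≢ G xw (sym w≡x)
      ¬xw : ¬ Pair x y x w
      ¬xw (inj₁ (_ , w≡y)) = adj⇒≢ G yw (sym w≡y)
      ¬xw (inj₂ (x≡y , _)) = x≢y x≡y
      z∉ : z ∉ x ∷ y ∷ w ∷ []
      z∉ (here z≡x)                 = x≢z (sym z≡x)
      z∉ (there (here z≡y))         = y≢z (sym z≡y)
      z∉ (there (there (here z≡w))) = w≢z (sym z≡w)

  cIn≤1+R : ∀ S → cIn G S ≤ suc (cIn R S)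
  cIn≤1+R S = cIn≤length G S sub
    where
    sub : ∀ {i j} → Edge G S i j → col G i j ∈ col G x y ∷ palette R S
    sub {i} {j} e with pair? x y i j
    ... | yes p = here (pair-col G xy p)
    ... | no ¬p = there (subst (_∈ palette R S) (R-other ¬p) (∈-palette⁺ R S e))

  1+R≤cIn : ∀ S → (∀ {i} → i ∈ corners → i ∈ˢ S) → suc (cIn R S) ≤ cIn G S
  1+R≤cIn S corners⊆S = length-mono-unique (All.tabulate xy-new ∷ palette-unique R S) sub
    where
    sub : col G x y ∷ palette R S ⊆ palette G S
    sub (here refl) = ∈-palette⁺ G S (corners⊆S x∈ , corners⊆S y∈ , xy)
    sub (there c∈) with ∈-palette⁻ R S c∈
    ... | i , j , e , refl with pair? x y i j
    ... | yes p = subst (_∈ palette G S) (sym (R-xy p)) (∈-palette⁺ G S (corners⊆S x∈ , corners⊆S z∈ , xz))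
    ... | no ¬p = subst (_∈ palette G S) (sym (R-other ¬p)) (∈-palette⁺ G S e)
    xy-new : ∀ {c} → c ∈ palette R S → col G x y ≢ c
    xy-new c∈ eq with ∈-palette⁻ R S c∈
    ... | i , j , (_ , _ , ij) , refl with pair? x y i j
    ... | yes p = xy≢xz (trans eq (R-xy p))
    ... | no ¬p = ¬p (colour-unique x∈ y∈ x≢y ij (trans (sym (R-other ¬p)) (sym eq)))

  R∈G0 : IsG0 R full
  R∈G0 = heavy⇒G0 _ R full ≤-refl ne-full R-rainbowFree (≤-trans heavy
    (≤-trans (+-monoʳ-≤ (eG G) (cIn≤1+R full)) (≤-reflexive (+-suc (eG G) (cG R)))))

  confined : ∀ {a b i j} → a ∈ corners → b ∈ corners → a ≢ b → adj G i j ≡ true →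
             col R i j ≡ col R a b → i ∈ corners × j ∈ corners
  confined {a} {b} {i} {j} a∈ b∈ a≢b ij eq with pair? x y i j | pair? x y a b
  ... | yes p | _     = pair⇒∈′ x∈ y∈ p
  ... | no ¬p | yes q = pair⇒∈′ x∈ z∈ (colour-unique x∈ z∈ x≢z ij (trans (sym (R-other ¬p)) (trans eq (R-xy q))))
  ... | no ¬p | no ¬q =
    pair⇒∈′ a∈ b∈ (colour-unique a∈ b∈ a≢b ij (trans (sym (R-other ¬p)) (trans eq (R-other ¬q))))

  module _ (S : VSet n) (corners⊆S : ∀ {i} → i ∈ corners → i ∈ˢ S) where

    3≤size : 3 ≤ size S
    3≤size = length≤size S ((x≢y ∷ x≢z ∷ []) ∷ (y≢z ∷ []) ∷ [] ∷ []) corners⊆S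

    nonCorner : 4 ≤ size S → ∃ λ w → w ∈ˢ S × w ∉ corners
    nonCorner 4≤ with find-∈ˢ (S ∖ (λ i → does (any? (i Fin.≟_) corners)))
    ... | inj₁ (w , w∈) with ∖⁻ S (λ i → does (any? (i Fin.≟_) corners)) w∈
    ... | w∈S , w∉ = w , w∈S , w∉ ∘ dec-true (any? (w Fin.≟_) corners)
    nonCorner 4≤ | inj₂ none = contradiction (≤-trans 4≤ (size≤length S sub)) λ { (s≤s (s≤s (s≤s ()))) }
      where
      sub : ∀ {i} → i ∈ˢ S → i ∈ corners
      sub {i} i∈ with any? (i Fin.≟_) corners in eq
      ... | yes p = p
      ... | no ¬p = contradiction (∖⁺ S (λ i → does (any? (i Fin.≟_) corners)) i∈
                                     (¬p ∘ does⁻ (any? (i Fin.≟_) corners))) none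

    cIn≡size : 2 ≤ size S → cIn R S ≡ size S ∸ 1 → cIn G S ≡ size S
    cIn≡size 2≤ eq = begin
      cIn G S            ≡⟨ ≤-antisym (cIn≤1+R S) (1+R≤cIn S corners⊆S) ⟩
      suc (cIn R S)      ≡⟨ cong suc eq ⟩
      suc (size S ∸ 1)   ≡⟨ m+[n∸m]≡n (≤-trans (s≤s z≤n) 2≤) ⟩
      size S             ∎
      where open ≡-Reasoning

    not-separated : 4 ≤ size S → Complete G S → (A B : VSet n) → Bipartition S A B → Mono R A B →
                    ∀ {a b} → a ∈ corners → b ∈ corners → a ∈ˢ A → ¬ b ∈ˢ B
    not-separated 4≤ compl A B (cover , subA , subB , disj) (κ , mono) {a} {b} a∈ b∈ a∈A b∈B
      with nonCorner 4≤
    ... | w , w∈ , w∉ with cover w w∈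
    ... | inj₁ w∈A = w∉ (proj₁ (confined a∈ b∈ (λ { refl → disj _ a∈A b∈B })
                       (compl w b w∈ (subB b b∈B) λ { refl → disj _ w∈A b∈B })
                       (trans (mono w b w∈A b∈B) (sym (mono a b a∈A b∈B)))))
    ... | inj₂ w∈B = w∉ (proj₂ (confined a∈ b∈ (λ { refl → disj _ a∈A b∈B })
                       (compl a w (subA a a∈A) w∈ λ { refl → disj _ a∈A w∈B })
                       (trans (mono a w a∈A w∈B) (sym (mono a b a∈A b∈B)))))

    join : 4 ≤ size S → Complete G S → cIn G S ≡ size S → (A B : VSet n) → Bipartition S A B → Mono R A B →
           (∀ {i} → i ∈ corners → i ∈ˢ A) → IsG1 G A → IsG0 R B → IsG1 G S
    join 4≤ compl cIn≡ A B bip@(_ , _ , _ , disj) (κ , mono) corners⊆A gA gB =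
      g1-split 4≤ compl cIn≡ A B bip
        (κ , λ i j i∈ j∈ → trans (sym (R-other (notBoth i j j∈))) (mono i j i∈ j∈))
        gA (isG0-cong R G B refl (λ {i} {j} _ j∈ → R-other (notBoth i j j∈)) gB)
      where
      notBoth : ∀ i j → j ∈ˢ B → ¬ Pair x y i j
      notBoth i j j∈ (inj₁ (_ , refl)) = disj _ (corners⊆A y∈) j∈
      notBoth i j j∈ (inj₂ (_ , refl)) = disj _ (corners⊆A x∈) j∈

  R∈G0⇒G∈G1 : ∀ S → (∀ {i} → i ∈ corners → i ∈ˢ S) → IsG0 R S → IsG1 G S
  R∈G0⇒G∈G1 S sub (g0-K1 eq) = contradiction (sub x∈ , sub y∈ , xy) (noEdges G S (≤-reflexive eq))
  R∈G0⇒G∈G1 S sub (g0-split 2≤ compl cR≡ A B bip@(cover , _) _ _ mono gA gB)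
    with size S ≤? 3 | cover x (sub x∈)
  ... | yes ≤3 | _ = g1-C3 size≡3 compl (trans (cIn≡size S sub 2≤ cR≡) size≡3)
    where
    size≡3 : size S ≡ 3
    size≡3 = ≤-antisym ≤3 (3≤size S sub)
  ... | no ≰3 | inj₁ x∈A =
    join S sub (≰⇒> ≰3) compl (cIn≡size S sub 2≤ cR≡) A B bip mono sub′ (R∈G0⇒G∈G1 A sub′ gA) gB
    where
    sub′ : ∀ {i} → i ∈ corners → i ∈ˢ A
    sub′ {i} i∈ with cover i (sub i∈)
    ... | inj₁ p = p
    ... | inj₂ p = contradiction p (not-separated S sub (≰⇒> ≰3) compl A B bip mono x∈ i∈ x∈A)
  ... | no ≰3 | inj₂ x∈B = join S sub (≰⇒> ≰3) compl (cIn≡size S sub 2≤ cR≡) B A (bipartition-swap S A B bip)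
                             (mono-swap R S A B compl bip mono) sub′ (R∈G0⇒G∈G1 B sub′ gB) gA
    where
    sub′ : ∀ {i} → i ∈ corners → i ∈ˢ B
    sub′ {i} i∈ with cover i (sub i∈)
    ... | inj₂ p = p
    ... | inj₁ p = contradiction x∈B (not-separated S sub (≰⇒> ≰3) compl A B bip mono i∈ x∈ p)

  G∈G1 : IsG1 G full
  G∈G1 = R∈G0⇒G∈G1 full (λ _ → refl) R∈G0

not-does⁺ : ∀ {k l : ℕ} → k ≢ l → not (does (k ≟ l)) ≡ true
not-does⁺ {k} {l} k≢l = cong not (dec-false (k ≟ l) k≢l)

not-does⁻ : ∀ (k l : ℕ) → not (does (k ≟ l)) ≡ true → k ≢ l
not-does⁻ k l p k≡l = not⁻ {does (k ≟ l)} p (dec-true (k ≟ l) k≡l)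

triples : ∀ n → List (Fin n × Fin n × Fin n)
triples n = concatMap (λ a → concatMap (λ b → map (λ c → a , b , c) (allFin n)) (allFin n)) (allFin n)

∈-rainbowTriangles⁺ : (G : ECGraph n) → ∀ {a b c} → Rainbow G a b c → toℕ a < toℕ b → toℕ b < toℕ c →
                      (a , b , c) ∈ rainbowTriangles G
∈-rainbowTriangles⁺ G {a} {b} {c} (rainbow ab bc ac p q r) a<b b<c = ∈-filter⁺ _
  (∈-concat⁺′ (∈-concat⁺′ (∈-map⁺ (λ c → a , b , c) (∈-allFin c)) (∈-map⁺ _ (∈-allFin b))) (∈-map⁺ _ (∈-allFin a)))
  (≡⇒T (∧⁺ (T⇒≡ (<⇒<ᵇ a<b)) (∧⁺ (T⇒≡ (<⇒<ᵇ b<c)) (∧⁺ ab (∧⁺ bc (∧⁺ ac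
    (∧⁺ (not-does⁺ p) (∧⁺ (not-does⁺ q) (not-does⁺ r)))))))))

∈-rainbowTriangles⁻ : (G : ECGraph n) → ∀ {a b c} → (a , b , c) ∈ rainbowTriangles G → Rainbow G a b c
∈-rainbowTriangles⁻ {n} G {a} {b} {c} t∈ with ∧⁻ {toℕ a <ᵇ toℕ b} (T⇒≡ (proj₂ (∈-filter⁻ _ {xs = triples n} t∈)))
... | _ , t with ∧⁻ {toℕ b <ᵇ toℕ c} t
... | _ , t with ∧⁻ {adj G a b} t
... | ab , t with ∧⁻ {adj G b c} t
... | bc , t with ∧⁻ {adj G a c} t
... | ac , t with ∧⁻ {not (does (col G a b ≟ col G b c))} t
... | p , t with ∧⁻ {not (does (col G a b ≟ col G a c))} t
... | q , r = rainbow ab bc ac (not-does⁻ _ _ p) (not-does⁻ _ _ q) (not-does⁻ _ _ r)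

rainbow-insert : (G : ECGraph n) → ∀ {a b c} → Rainbow G a b c → toℕ a < toℕ b → ∃ λ p → ∃ λ q → ∃ λ r →
  (p , q , r) ∈ rainbowTriangles G × (p ∷ q ∷ r ∷ []) ⊆ (a ∷ b ∷ c ∷ [])
rainbow-insert G {a} {b} {c} t a<b with Fin.<-cmp a c | Fin.<-cmp b c
... | tri≈ _ a≡c _ | _ = contradiction a≡c (adj⇒≢ G (Rainbow.ac t))
... | _ | tri≈ _ b≡c _ = contradiction b≡c (adj⇒≢ G (Rainbow.bc t))
... | _ | tri< b<c _ _ = a , b , c , ∈-rainbowTriangles⁺ G t a<b b<c , id
... | tri< a<c _ _ | tri> _ _ c<b = a , c , b ,
  ∈-rainbowTriangles⁺ G (rainbow-swap G (rainbow-rotate G (rainbow-rotate G t))) a<c c<b ,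
  λ { (here e) → here e ; (there (here e)) → there (there (here e)) ; (there (there (here e))) → there (here e) }
... | tri> _ _ c<a | _ = c , a , b , ∈-rainbowTriangles⁺ G (rainbow-rotate G (rainbow-rotate G t)) c<a a<b ,
  λ { (here e) → there (there (here e)) ; (there (here e)) → here e ; (there (there (here e))) → there (here e) }

rainbow-sort : (G : ECGraph n) → ∀ {a b c} → Rainbow G a b c → ∃ λ p → ∃ λ q → ∃ λ r →
  (p , q , r) ∈ rainbowTriangles G × (p ∷ q ∷ r ∷ []) ⊆ (a ∷ b ∷ c ∷ [])
rainbow-sort G {a} {b} {c} t with Fin.<-cmp a b
... | tri≈ _ a≡b _ = contradiction a≡b (adj⇒≢ G (Rainbow.ab t))
... | tri< a<b _ _ = rainbow-insert G t a<b
... | tri> _ _ b<a with rainbow-insert G (rainbow-swap G t) b<a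
... | p , q , r , t∈ , sub = p , q , r , t∈ , swapped ∘ sub
  where
  swapped : (b ∷ a ∷ c ∷ []) ⊆ (a ∷ b ∷ c ∷ [])
  swapped (here e)          = there (here e)
  swapped (there (here e))  = here e
  swapped (there (there c∈)) = there (there c∈)

theorem3 : (n : ℕ) → 3 ≤ n → (G : ECGraph n) →
    (n + 1) C 2 ≤ eG G + cG G →
    length (rainbowTriangles G) ≡ 1 →
    IsG1 G full
theorem3 n _ G heavy one with rainbowTriangles G in eq
theorem3 n _ G heavy refl | (x , y , z) ∷ [] = UniqueTriangle.G∈G1 G xyz only
    (subst (_≤ weight G full) (trans ([n+1]C2≡tri n) (cong tri (sym (size-full n)))) heavy)
  where
  xyz : Rainbow G x y z
  xyz = ∈-rainbowTriangles⁻ G (subst ((x , y , z) ∈_) (sym eq) (here refl))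
  only : ∀ {a b c} → Rainbow G a b c → (x ∷ y ∷ z ∷ []) ⊆ (a ∷ b ∷ c ∷ [])
  only t with rainbow-sort G t
  ... | _ , _ , _ , t∈ , sub with subst (_ ∈_) eq t∈
  ... | here refl = sub
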